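{- (i) Let $S\equiv\pm\{4, 5, 6, 7, 15, 17, 23, 25, 26, 33, 35, 36\}\pmod{80}$ and $T\equiv\pm\{2, 5, 11, 12, 15, 18, 19, 21, 25, 28, 29, 35\}\pmod{80}$. Then $p(S,n)=p(T,n)$ for all integers $n\ge0$ with $n\neq 2$. (ii) Let $S\equiv\pm\{3, 4, 5, 13, 14, 15, 25, 27, 34, 35, 36, 37\}\pmod{80}$ and $T\equiv\pm\{1, 5, 9, 12, 15, 22, 25, 28, 31, 35, 38, 39\}\pmod{80}$. Then $p(S,n)=p(T,n-3)$ for all $n\geq 3$.
   Context: For a set $S$ of positive integers and an integer $n\ge 0$, $p(S,n)$ denotes the number of partitions of $n$ into parts belonging to $S$ (so $p(S,0)=1$). The notation $S\equiv\pm\{r_1,\dots,r_k\}\pmod M$ means that $S$ is the set of all positive integers $n$ such that $n\equiv r_i$ or $n\equiv -r_i\pmod M$ for some $i$. -}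

module Defs where

open import Data.Nat using (ℕ; zero; suc; _+_; _*_; _∸_; _≤ᵇ_; _≡ᵇ_)
open import Data.Nat.DivMod using (_%_)
open import Data.Bool using (Bool; true; false; _∨_; if_then_else_)
open import Data.List using (List; []; _∷_; map; upTo; filterᵇ)
open import Data.Bool.ListAction using (any)
open import Data.Nat.ListAction using (sum)

-- A set of positive integers, given by its (decidable) characteristic function.
-- Only its values on positive integers matter (parts are always ≥ 1).
PartSet : Set
PartSet = ℕ → Bool

pmSet : (M : ℕ) → List ℕ → PartSet
pmSet zero    rs n       = false
pmSet (suc m) rs zero    = false
pmSet (suc m) rs (suc n) =
  any (λ r → (((suc n) % (suc m)) ≡ᵇ (r % (suc m))) ∨ (((suc n + r) % (suc m)) ≡ᵇ 0)) rs

-- pBounded S k n = number of partitions of n into parts belonging to S with all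
-- parts ≤ k.  Recursion on k: choose the multiplicity j of the part k+1
-- (j = 0 only, if k+1 ∉ S), the rest is a partition of n - j(k+1) with parts ≤ k.
pBounded : PartSet → ℕ → ℕ → ℕ
pBounded S zero    zero    = 1
pBounded S zero    (suc n) = 0
pBounded S (suc k) n with S (suc k)
... | false = pBounded S k n
... | true  = sum (map (λ j → pBounded S k (n ∸ j * suc k))
                       (filterᵇ (λ j → j * suc k ≤ᵇ n) (upTo (suc n))))

-- p(S,n): number of partitions of n into parts from S (parts are ≤ n, so bound n).
p : PartSet → ℕ → ℕ
p S n = pBounded S n n

{-# OPTIONS --safe #-}
module Submission where

-- Write f(±q^a, ±q^b) = ∑_k (±1)^k q^(((a+b)k² + (a-b)k)/2), θ₈₀(r) = f(q^r, q^(80-r)) and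
--   x = f(q,q³⁹) f(q⁹,q³¹),  y = f(q³,q³⁷) f(q¹³,q²⁷),  z = f(q¹¹,q²⁹) f(q¹⁹,q²¹),
--   w = f(q⁷,q³³) f(q¹⁷,q²³),  f₂ = f(q²,q¹⁸),  f₆ = f(q⁶,q¹⁴),
--   Δ = f(-q⁵,-q¹⁵) f(-q⁴,-q³⁶) f(-q¹²,-q²⁸).
-- By the Jacobi triple product, the generating functions of p(S,n) and p(T,n) are w f₆ / Δ and
-- z f₂ / Δ in part (i), y f₆ / Δ and x f₂ / Δ in part (ii). Hence the two claims are
--   z f₂ - w f₆ = q² Δ  and  y f₆ - q³ x f₂ = Δ.
-- The substitution (i, j) = (u - v, u + v) or (u - v, u + v + 1) in the double series of a product
-- of two thetas expresses x, y, z, w and f(-q⁴,-q³⁶) f(-q¹²,-q²⁸) through the θ₈₀(r), and splitting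
-- the series of f₂, f₆ and f(-q⁵,-q¹⁵) by parity does the same for them; both identities then
-- hold as polynomial identities in q and the θ₈₀(r).

open import Defs
open import Algebra.Bundles using (CommutativeMonoid; CommutativeRing)
open import Data.Bool using (Bool; true; false; T; _∨_; if_then_else_)
open import Data.Bool.ListAction using (or)
open import Data.Integer as ℤ using (ℤ; +_; -[1+_]; ∣_∣)
import Data.Integer.Properties as ℤ
open import Data.Integer.Tactic.RingSolver using (solve-∀)
open import Data.List using (List; []; _∷_; _++_; foldr; map; applyUpTo; filterᵇ)
open import Data.List.Properties using (map-cong)
open import Data.List.Relation.Binary.Permutation.Propositional as Perm
  using (_↭_; ↭-sym; ↭-trans; ↭-reflexive)
open import Data.Nat as ℕ using (ℕ; zero; suc; _≥_; _∸_; _≤ᵇ_; _≡ᵇ_)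
open import Data.Nat.DivMod using (_%_; [m+kn]%n≡m%n)
open import Data.Nat.ListAction using (sum)
import Data.Nat.Properties as ℕ
open import Data.Nat.Tactic.RingSolver using () renaming (solve-∀ to solve-∀ℕ)
open import Data.List.Sort.Base ℕ.≤-totalOrder using (module SortingAlgorithm)
open import Data.List.Sort.InsertionSort ℕ.≤-decTotalOrder using (insertionSort)
open import Data.Product using (∃; _×_; _,_; proj₁; proj₂)
open import Data.Unit using (tt)
open import Function using (_∘_; id)
open import Level using (0ℓ)
open import Relation.Nullary using (¬_; yes; no; contradiction)
open import Relation.Binary.PropositionalEquality as ≡ using (_≡_; _≢_; cong; cong₂; subst)
import Algebra.Properties.Group as GroupProperties
import Algebra.Properties.Ring as RingProperties
import Algebra.Properties.Semiring.Exp as Exp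
import Algebra.Solver.CommutativeMonoid as CommutativeMonoidSolver
import Algebra.Solver.Ring.NaturalCoefficients.Default as SemiringSolver

-- The theta and product arguments live in an arbitrary commutative ring with an element q whose
-- powers from the K-th on vanish. There theta series and infinite products have only finitely many
-- nontrivial terms and factors, so no limits occur. The ring of series modulo q^K enters only at
-- the end, with K = n + 1 when coefficients of q^n are compared. The triple product is derived from
-- its finite form, a sum over Gaussian binomial coefficients, taken at an index so large that
-- modulo q^K the coefficients have become constant. Each factor 1 - q^j with j ≥ 1 is a unit, hence
-- so is Δ. Cancelling it leaves F_T = F_S + q² in part (i), whose last term is the exception n = 2,
-- and F_S = q³ F_T + 1 in part (ii), whose last term is invisible for n ≥ 3. Minus signs occur only
-- through σ = -1. They are moved to the other side of each equation, so that the algebra can be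
-- normalised over commutative semirings.

-- Finite sums and products in a commutative monoid.

module FiniteFold {c ℓ} (M : CommutativeMonoid c ℓ) where
  open CommutativeMonoid M
  open import Relation.Binary.Reasoning.Setoid setoid
  open import Algebra.Properties.CommutativeSemigroup commutativeSemigroup using (interchange)

  fold : ℕ → (ℕ → Carrier) → Carrier
  fold zero    f = ε
  fold (suc n) f = f 0 ∙ fold n (f ∘ suc)

  fold-cong : ∀ n {f g} → (∀ i → i ℕ.< n → f i ≈ g i) → fold n f ≈ fold n g
  fold-cong zero    h = refl
  fold-cong (suc n) h = ∙-cong (h 0 (ℕ.s≤s ℕ.z≤n)) (fold-cong n (λ i i<n → h (suc i) (ℕ.s≤s i<n)))

  fold-cong′ : ∀ n {f g} → (∀ i → f i ≈ g i) → fold n f ≈ fold n g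
  fold-cong′ n h = fold-cong n (λ i _ → h i)

  fold-ε : ∀ n → fold n (λ _ → ε) ≈ ε
  fold-ε zero    = refl
  fold-ε (suc n) = trans (identityˡ _) (fold-ε n)

  fold-∙ : ∀ n f g → fold n (λ i → f i ∙ g i) ≈ fold n f ∙ fold n g
  fold-∙ zero    f g = sym (identityˡ ε)
  fold-∙ (suc n) f g = trans (∙-congˡ (fold-∙ n (f ∘ suc) (g ∘ suc))) (interchange _ _ _ _)

  fold-swap : ∀ m n (f : ℕ → ℕ → Carrier) →
              fold m (λ i → fold n (f i)) ≈ fold n (λ j → fold m (λ i → f i j))
  fold-swap zero    n f = sym (fold-ε n)
  fold-swap (suc m) n f =
    trans (∙-congˡ (fold-swap m n (f ∘ suc))) (sym (fold-∙ n (f 0) _))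

  fold-+ : ∀ m n f → fold (m ℕ.+ n) f ≈ fold m f ∙ fold n (λ i → f (m ℕ.+ i))
  fold-+ zero    n f = sym (identityˡ _)
  fold-+ (suc m) n f = trans (∙-congˡ (fold-+ m n (f ∘ suc))) (sym (assoc _ _ _))

  fold-last : ∀ n f → fold (suc n) f ≈ fold n f ∙ f n
  fold-last zero    f = comm _ _
  fold-last (suc n) f = trans (∙-congˡ (fold-last n (f ∘ suc))) (sym (assoc _ _ _))

  -- Grouping by residues modulo d. With d = 2 this splits sums by parity and doubles the modulus of
  -- a product; with d = 80 it sorts the parts of a partition into residue classes.
  fold-block : ∀ n d f → fold (n ℕ.* d) f ≈ fold n (λ i → fold d (λ r → f (r ℕ.+ i ℕ.* d)))
  fold-block zero    d f = refl
  fold-block (suc n) d f = begin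
    fold (d ℕ.+ n ℕ.* d) f
      ≈⟨ fold-+ d (n ℕ.* d) f ⟩
    fold d f ∙ fold (n ℕ.* d) (λ i → f (d ℕ.+ i))
      ≈⟨ ∙-cong (fold-cong′ d (λ r → reflexive (cong f (≡.sym (ℕ.+-identityʳ r)))))
                (fold-block n d _) ⟩
    fold d (λ r → f (r ℕ.+ 0)) ∙ fold n (λ i → fold d (λ r → f (d ℕ.+ (r ℕ.+ i ℕ.* d))))
      ≈⟨ ∙-congˡ (fold-cong′ n (λ i → fold-cong′ d (λ r → reflexive (cong f (exchange r (i ℕ.* d)))))) ⟩
    fold d (λ r → f (r ℕ.+ 0)) ∙ fold n (λ i → fold d (λ r → f (r ℕ.+ (d ℕ.+ i ℕ.* d)))) ∎
    where
    exchange : ∀ r x → d ℕ.+ (r ℕ.+ x) ≡ r ℕ.+ (d ℕ.+ x)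
    exchange r x = ≡.trans (≡.sym (ℕ.+-assoc d r x))
                     (≡.trans (cong (ℕ._+ x) (ℕ.+-comm d r)) (ℕ.+-assoc r d x))

  fold-extend : ∀ n d {f} → (∀ i → n ℕ.≤ i → f i ≈ ε) → fold (n ℕ.+ d) f ≈ fold n f
  fold-extend n d {f} f≈ε = begin
    fold (n ℕ.+ d) f
      ≈⟨ fold-+ n d f ⟩
    fold n f ∙ fold d (λ i → f (n ℕ.+ i))
      ≈⟨ ∙-congˡ (trans (fold-cong′ d (λ i → f≈ε _ (ℕ.m≤m+n n i))) (fold-ε d)) ⟩
    fold n f ∙ ε
      ≈⟨ identityʳ _ ⟩
    fold n f ∎

-- Finite bilateral sums over the integers.

∣k∣≤∣c∣+∣k+c∣ : ∀ c k → ∣ k ∣ ℕ.≤ ∣ c ∣ ℕ.+ ∣ k ℤ.+ c ∣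
∣k∣≤∣c∣+∣k+c∣ c k = begin
  ∣ k ∣                       ≡⟨ cong ∣_∣ (regroup c k) ⟩
  ∣ (ℤ.- c) ℤ.+ (k ℤ.+ c) ∣   ≤⟨ ℤ.∣i+j∣≤∣i∣+∣j∣ (ℤ.- c) (k ℤ.+ c) ⟩
  ∣ ℤ.- c ∣ ℕ.+ ∣ k ℤ.+ c ∣   ≡⟨ cong (ℕ._+ ∣ k ℤ.+ c ∣) (ℤ.∣-i∣≡∣i∣ c) ⟩
  ∣ c ∣ ℕ.+ ∣ k ℤ.+ c ∣       ∎
  where
  open ℕ.≤-Reasoning
  regroup : ∀ c k → k ≡ (ℤ.- c) ℤ.+ (k ℤ.+ c)
  regroup = solve-∀

-- The integers of [- L , L) are summed; with this half-open range, parity splits the range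
-- [- 2 L , 2 L) into two copies of [- L , L).
module BilateralSum {c ℓ} (R : CommutativeRing c ℓ) where
  open CommutativeRing R
  open import Relation.Binary.Reasoning.Setoid setoid
  open FiniteFold +-commutativeMonoid
  open import Algebra.Properties.CommutativeSemigroup
    (CommutativeMonoid.commutativeSemigroup +-commutativeMonoid) using (interchange)

  -- The bound is strict: nonzero values need |k| < B. Hence the lopsided range [- B , B) already
  -- contains the support.
  SupportedIn : ℕ → (ℤ → Carrier) → Set ℓ
  SupportedIn B g = ∀ k → B ℕ.≤ ∣ k ∣ → g k ≈ 0#

  fold-*ˡ : ∀ n x f → x * fold n f ≈ fold n (λ i → x * f i)
  fold-*ˡ zero    x f = zeroʳ x
  fold-*ˡ (suc n) x f = trans (distribˡ _ _ _) (+-congˡ (fold-*ˡ n x (f ∘ suc)))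

  -- The successor by cases on the constructors, so that sums, signs and reciprocal factorials
  -- composed with it unfold by computation.
  next : ℤ → ℤ
  next (+ n)        = + suc n
  next -[1+ zero  ] = + 0
  next -[1+ suc n ] = -[1+ n ]

  next≡+1 : ∀ k → next k ≡ k ℤ.+ (+ 1)
  next≡+1 (+ n)        = cong +_ (≡.sym (ℕ.+-comm n 1))
  next≡+1 -[1+ zero  ] = ≡.refl
  next≡+1 -[1+ suc n ] = ≡.refl

  -- The map k ↦ - 1 - k exchanges the two halves of [- L , L), which negation does not preserve.
  -- Negation is then recovered as `next` after `reflect`.
  reflect : ℤ → ℤ
  reflect (+ n)    = -[1+ n ]
  reflect -[1+ n ] = + n

  next-reflect : ∀ k → next (reflect k) ≡ ℤ.- k
  next-reflect (+ zero)  = ≡.refl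
  next-reflect (+ suc n) = ≡.refl
  next-reflect -[1+ n ]  = ≡.refl

  opaque
    ∑ : ℕ → (ℤ → Carrier) → Carrier
    ∑ L g = fold L (λ i → g (+ i)) + fold L (λ i → g -[1+ i ])

    ∑-cong : ∀ L {f g} → (∀ k → ∣ k ∣ ℕ.≤ L → f k ≈ g k) → ∑ L f ≈ ∑ L g
    ∑-cong L h = +-cong (fold-cong L (λ i i<L → h (+ i) (ℕ.<⇒≤ i<L)))
                        (fold-cong L (λ i i<L → h -[1+ i ] i<L))

    ∑-+ : ∀ L f g → ∑ L (λ k → f k + g k) ≈ ∑ L f + ∑ L g
    ∑-+ L f g = trans (+-cong (fold-∙ L _ _) (fold-∙ L _ _)) (interchange _ _ _ _)

    ∑-swap : ∀ L L′ (f : ℤ → ℤ → Carrier) →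
             ∑ L (λ i → ∑ L′ (f i)) ≈ ∑ L′ (λ j → ∑ L (λ i → f i j))
    ∑-swap L L′ f = begin
      ∑ L (λ i → ∑ L′ (f i))
        ≈⟨ +-cong (fold-∙ L _ _) (fold-∙ L _ _) ⟩
      (fold L (λ i → fold L′ (λ j → f (+ i) (+ j))) + fold L (λ i → fold L′ (λ j → f (+ i) -[1+ j ])))
        + (fold L (λ i → fold L′ (λ j → f -[1+ i ] (+ j))) + fold L (λ i → fold L′ (λ j → f -[1+ i ] -[1+ j ])))
        ≈⟨ interchange _ _ _ _ ⟩
      (fold L (λ i → fold L′ (λ j → f (+ i) (+ j))) + fold L (λ i → fold L′ (λ j → f -[1+ i ] (+ j))))
        + (fold L (λ i → fold L′ (λ j → f (+ i) -[1+ j ])) + fold L (λ i → fold L′ (λ j → f -[1+ i ] -[1+ j ])))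
        ≈⟨ +-cong (+-cong (fold-swap L L′ _) (fold-swap L L′ _)) (+-cong (fold-swap L L′ _) (fold-swap L L′ _)) ⟩
      (fold L′ (λ j → fold L (λ i → f (+ i) (+ j))) + fold L′ (λ j → fold L (λ i → f -[1+ i ] (+ j))))
        + (fold L′ (λ j → fold L (λ i → f (+ i) -[1+ j ])) + fold L′ (λ j → fold L (λ i → f -[1+ i ] -[1+ j ])))
        ≈⟨ +-cong (fold-∙ L′ _ _) (fold-∙ L′ _ _) ⟨
      ∑ L′ (λ j → ∑ L (λ i → f i j)) ∎

    ∑-*ˡ : ∀ L x f → x * ∑ L f ≈ ∑ L (λ k → x * f k)
    ∑-*ˡ L x f = trans (distribˡ _ _ _) (+-cong (fold-*ˡ L x _) (fold-*ˡ L x _))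

    ∑-extend : ∀ L d {g} → SupportedIn L g → ∑ (L ℕ.+ d) g ≈ ∑ L g
    ∑-extend L d supp = +-cong (fold-extend L d (λ i L≤i → supp (+ i) L≤i))
                               (fold-extend L d (λ i L≤i → supp -[1+ i ] (ℕ.m≤n⇒m≤1+n L≤i)))

    -- The shift moves the range to (- L , L], so the term at - L is lost and the term at L is
    -- gained; both have to vanish.
    ∑-next : ∀ L {g} → g (+ L) ≈ 0# → g (ℤ.- (+ L)) ≈ 0# → ∑ L (g ∘ next) ≈ ∑ L g
    ∑-next zero    _  _ = refl
    ∑-next (suc n) {g} g⁺ g⁻ = begin
      fold (suc n) (λ i → g (+ suc i)) + (g (+ 0) + fold n (λ i → g -[1+ i ]))
        ≈⟨ +-congʳ (trans (fold-last n _) (trans (+-congˡ g⁺) (+-identityʳ _))) ⟩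
      fold n (λ i → g (+ suc i)) + (g (+ 0) + fold n (λ i → g -[1+ i ]))
        ≈⟨ trans (sym (+-assoc _ _ _)) (+-congʳ (+-comm _ _)) ⟩
      fold (suc n) (λ i → g (+ i)) + fold n (λ i → g -[1+ i ])
        ≈⟨ +-congˡ (trans (fold-last n _) (trans (+-congˡ g⁻) (+-identityʳ _))) ⟨
      ∑ (suc n) g ∎

    ∑-reflect : ∀ L g → ∑ L (g ∘ reflect) ≈ ∑ L g
    ∑-reflect L g = +-comm _ _

    ∑-parity : ∀ L g → ∑ (L ℕ.* 2) g ≈ ∑ L (λ k → g (k ℤ.+ k)) + ∑ L (λ k → g ((k ℤ.+ k) ℤ.+ (+ 1)))
    ∑-parity L g = begin
      ∑ (L ℕ.* 2) g
        ≈⟨ +-cong (fold-block L 2 _) (fold-block L 2 _) ⟩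
      fold L (λ i → g (+ (i ℕ.* 2)) + (g (+ (1 ℕ.+ i ℕ.* 2)) + 0#))
        + fold L (λ i → g -[1+ i ℕ.* 2 ] + (g -[1+ 1 ℕ.+ i ℕ.* 2 ] + 0#))
        ≈⟨ +-cong (fold-cong′ L λ i → +-cong (at (even⁺ i)) (trans (+-identityʳ _) (at (odd⁺ i))))
                  -- On the negative half the odd member - (2i + 1) precedes the even one - (2i +
                  -- 2), so the two are exchanged.
                  (fold-cong′ L λ i → trans (+-cong (at (odd⁻ i)) (trans (+-identityʳ _) (at (even⁻ i))))
                                            (+-comm _ _)) ⟩
      ∑ L (λ k → g (k ℤ.+ k) + g ((k ℤ.+ k) ℤ.+ (+ 1)))
        ≈⟨ ∑-+ L (λ k → g (k ℤ.+ k)) (λ k → g ((k ℤ.+ k) ℤ.+ (+ 1))) ⟩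
      ∑ L (λ k → g (k ℤ.+ k)) + ∑ L (λ k → g ((k ℤ.+ k) ℤ.+ (+ 1))) ∎
      where
      at : ∀ {j k} → j ≡ k → g j ≈ g k
      at e = reflexive (cong g e)
      double : ∀ i → i ℕ.* 2 ≡ i ℕ.+ i
      double i = ≡.trans (ℕ.*-comm i 2) (cong (i ℕ.+_) (ℕ.+-identityʳ i))
      even⁺ : ∀ i → + (i ℕ.* 2) ≡ + i ℤ.+ + i
      even⁺ i = cong +_ (double i)
      odd⁺ : ∀ i → + (1 ℕ.+ i ℕ.* 2) ≡ (+ i ℤ.+ + i) ℤ.+ (+ 1)
      odd⁺ i = cong +_ (≡.trans (cong suc (double i)) (ℕ.+-comm 1 (i ℕ.+ i)))
      odd⁻ : ∀ i → -[1+ i ℕ.* 2 ] ≡ (-[1+ i ] ℤ.+ -[1+ i ]) ℤ.+ (+ 1)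
      odd⁻ i = cong -[1+_] (double i)
      even⁻ : ∀ i → -[1+ 1 ℕ.+ i ℕ.* 2 ] ≡ -[1+ i ] ℤ.+ -[1+ i ]
      even⁻ i = cong (λ x → -[1+ suc x ]) (double i)

    ∑-single : ∀ L {g} → SupportedIn 1 g → ∑ (suc L) g ≈ g (+ 0)
    ∑-single L {g} supp = begin
      (g (+ 0) + fold L (λ i → g (+ suc i))) + fold (suc L) (λ i → g -[1+ i ])
        ≈⟨ +-cong (+-congˡ (trans (fold-cong′ L (λ i → supp _ (ℕ.s≤s ℕ.z≤n))) (fold-ε L)))
                  (trans (fold-cong′ (suc L) (λ i → supp -[1+ i ] (ℕ.s≤s ℕ.z≤n))) (fold-ε (suc L))) ⟩
      (g (+ 0) + 0#) + 0#
        ≈⟨ trans (+-identityʳ _) (+-identityʳ _) ⟩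
      g (+ 0) ∎

  ∑-cong′ : ∀ L {f g} → (∀ k → f k ≈ g k) → ∑ L f ≈ ∑ L g
  ∑-cong′ L h = ∑-cong L (λ k _ → h k)

  ∑-*ʳ : ∀ L x f → ∑ L f * x ≈ ∑ L (λ k → f k * x)
  ∑-*ʳ L x f = trans (*-comm _ _) (trans (∑-*ˡ L x f) (∑-cong′ L (λ k → *-comm _ _)))

  SupportedIn-shift : ∀ {B g} c → SupportedIn B g → SupportedIn (∣ c ∣ ℕ.+ B) (λ k → g (k ℤ.+ c))
  SupportedIn-shift c supp k c+B≤k =
    supp (k ℤ.+ c) (ℕ.+-cancelˡ-≤ ∣ c ∣ _ _ (ℕ.≤-trans c+B≤k (∣k∣≤∣c∣+∣k+c∣ c k)))

  private
    ∑-shift-1 : ∀ L {B g} → SupportedIn B g → B ℕ.≤ L → ∑ L (λ k → g (k ℤ.+ (+ 1))) ≈ ∑ L g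
    ∑-shift-1 L {B} {g} supp B≤L = trans
      (∑-cong′ L (λ k → reflexive (cong g (≡.sym (next≡+1 k)))))
      (∑-next L (supp _ B≤L) (supp _ (subst (B ℕ.≤_) (≡.sym (ℤ.∣-i∣≡∣i∣ (+ L))) B≤L)))

    ∑-shift⁺ : ∀ n L {B g} → SupportedIn B g → n ℕ.+ B ℕ.≤ L → ∑ L (λ k → g (k ℤ.+ + n)) ≈ ∑ L g
    ∑-shift⁺ zero L {g = g} supp h = ∑-cong′ L (λ k → reflexive (cong g (ℤ.+-identityʳ k)))
    ∑-shift⁺ (suc n) L {g = g} supp h = trans
      (∑-cong′ L (λ k → reflexive (cong g (≡.sym (ℤ.+-assoc k (+ 1) (+ n))))))
      (trans (∑-shift-1 L (SupportedIn-shift (+ n) supp) (ℕ.≤-trans (ℕ.n≤1+n _) h))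
             (∑-shift⁺ n L supp (ℕ.≤-trans (ℕ.n≤1+n _) h)))

    ∑-shift⁻ : ∀ n L {B g} → SupportedIn B g → n ℕ.+ B ℕ.≤ L → ∑ L (λ k → g (k ℤ.+ (ℤ.- + n))) ≈ ∑ L g
    ∑-shift⁻ zero L {g = g} supp h = ∑-cong′ L (λ k → reflexive (cong g (ℤ.+-identityʳ k)))
    ∑-shift⁻ (suc n) L {B} {g} supp h = trans
      (sym (∑-shift-1 L (SupportedIn-shift -[1+ n ] supp) h))
      (trans (∑-cong′ L (λ k → reflexive (cong g (lemma k (+ n)))))
             (∑-shift⁻ n L supp (ℕ.≤-trans (ℕ.n≤1+n _) h)))
      where
      lemma : ∀ k n → (k ℤ.+ (+ 1)) ℤ.+ (ℤ.- ((+ 1) ℤ.+ n)) ≡ k ℤ.+ (ℤ.- n)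
      lemma = solve-∀

  ∑-shift : ∀ c L {B g} → SupportedIn B g → ∣ c ∣ ℕ.+ B ℕ.≤ L → ∑ L (λ k → g (k ℤ.+ c)) ≈ ∑ L g
  ∑-shift (+ n)    = ∑-shift⁺ n
  ∑-shift -[1+ n ] = ∑-shift⁻ (suc n)

  ∑-neg : ∀ L {g} → SupportedIn L g → ∑ L (λ k → g (ℤ.- k)) ≈ ∑ L g
  ∑-neg L {g} supp = begin
    ∑ L (λ k → g (ℤ.- k))
      ≈⟨ ∑-cong′ L (λ k → reflexive (cong g (next-reflect k))) ⟨
    ∑ L (λ k → g (next (reflect k)))
      ≈⟨ ∑-reflect L (g ∘ next) ⟩
    ∑ L (g ∘ next)
      ≈⟨ ∑-next L (supp (+ L) ℕ.≤-refl) (supp _ (ℕ.≤-reflexive (≡.sym (ℤ.∣-i∣≡∣i∣ (+ L))))) ⟩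
    ∑ L g ∎

  -- Put j = l + i, sum over l outside, split l into 2v and 2v + 1, and recentre i = u - v. Each
  -- pair (i, j) is reached exactly once, since the parity of j - i decides the case. Shifts of size
  -- up to M move the support out of [- M , M), hence the doubled inner range.
  ∑∑-rotate : ∀ M (h : ℤ → ℤ → Carrier) →
    (∀ i → SupportedIn M (h i)) → (∀ j → SupportedIn M (λ i → h i j)) →
    ∑ M (λ i → ∑ M (h i)) ≈
      ∑ M (λ v → ∑ (M ℕ.* 2) (λ u → h (u ℤ.- v) (u ℤ.+ v)))
      + ∑ M (λ v → ∑ (M ℕ.* 2) (λ u → h (u ℤ.- v) ((u ℤ.+ v) ℤ.+ (+ 1))))
  ∑∑-rotate M h suppʳ suppˡ = begin
    ∑ M (λ i → ∑ M (h i))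
      ≈⟨ ∑-cong′ M (λ i → ∑-widen (suppʳ i)) ⟨
    ∑ M (λ i → ∑ (M ℕ.* 2) (h i))
      ≈⟨ ∑-cong M (λ i i≤M → ∑-shift i (M ℕ.* 2) (suppʳ i) (bound i i≤M)) ⟨
    ∑ M (λ i → ∑ (M ℕ.* 2) (λ l → h i (l ℤ.+ i)))
      ≈⟨ ∑-swap M (M ℕ.* 2) _ ⟩
    ∑ (M ℕ.* 2) (λ l → ∑ M (λ i → h i (l ℤ.+ i)))
      ≈⟨ ∑-parity M _ ⟩
    ∑ M (λ v → ∑ M (λ i → h i ((v ℤ.+ v) ℤ.+ i)))
      + ∑ M (λ v → ∑ M (λ i → h i (((v ℤ.+ v) ℤ.+ (+ 1)) ℤ.+ i)))
      ≈⟨ +-cong (∑-cong M (λ v v≤M → recentre (v ℤ.+ v) v v≤M (λ u → cong (h _) (even u v))))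
                (∑-cong M (λ v v≤M → recentre ((v ℤ.+ v) ℤ.+ (+ 1)) v v≤M (λ u → cong (h _) (odd u v)))) ⟩
    ∑ M (λ v → ∑ (M ℕ.* 2) (λ u → h (u ℤ.- v) (u ℤ.+ v)))
      + ∑ M (λ v → ∑ (M ℕ.* 2) (λ u → h (u ℤ.- v) ((u ℤ.+ v) ℤ.+ (+ 1)))) ∎
    where
    M*2≡M+M : M ℕ.* 2 ≡ M ℕ.+ M
    M*2≡M+M = ≡.trans (ℕ.*-comm M 2) (cong (M ℕ.+_) (ℕ.+-identityʳ M))
    ∑-widen : ∀ {g} → SupportedIn M g → ∑ (M ℕ.* 2) g ≈ ∑ M g
    ∑-widen {g} supp = trans (reflexive (cong (λ L → ∑ L g) M*2≡M+M)) (∑-extend M M supp)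
    bound : ∀ i → ∣ i ∣ ℕ.≤ M → ∣ i ∣ ℕ.+ M ℕ.≤ M ℕ.* 2
    bound i i≤M = ℕ.≤-trans (ℕ.+-monoˡ-≤ M i≤M) (ℕ.≤-reflexive (≡.sym M*2≡M+M))
    recentre : ∀ l v → ∣ v ∣ ℕ.≤ M → {f : ℤ → Carrier} → (∀ u → h (u ℤ.- v) (l ℤ.+ (u ℤ.- v)) ≡ f u) →
               ∑ M (λ i → h i (l ℤ.+ i)) ≈ ∑ (M ℕ.* 2) f
    recentre l v v≤M {f} e = begin
      ∑ M g                                ≈⟨ ∑-widen supp ⟨
      ∑ (M ℕ.* 2) g                        ≈⟨ ∑-shift (ℤ.- v) (M ℕ.* 2) supp
                                                (bound (ℤ.- v) (ℕ.≤-trans (ℕ.≤-reflexive (ℤ.∣-i∣≡∣i∣ v)) v≤M)) ⟨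
      ∑ (M ℕ.* 2) (λ u → g (u ℤ.- v))      ≈⟨ ∑-cong′ (M ℕ.* 2) (λ u → reflexive (e u)) ⟩
      ∑ (M ℕ.* 2) f                        ∎
      where
      g : ℤ → Carrier
      g i = h i (l ℤ.+ i)
      supp : SupportedIn M g
      supp i M≤i = suppˡ (l ℤ.+ i) i M≤i
    even : ∀ u v → (v ℤ.+ v) ℤ.+ (u ℤ.- v) ≡ u ℤ.+ v
    even = solve-∀
    odd : ∀ u v → ((v ℤ.+ v) ℤ.+ (+ 1)) ℤ.+ (u ℤ.- v) ≡ (u ℤ.+ v) ℤ.+ (+ 1)
    odd = solve-∀

-- The quadratic exponents of theta series.

triangle : ℕ → ℕ
triangle zero    = 0
triangle (suc n) = n ℕ.+ triangle n

-- This is a k(k+1)/2 + b k(k-1)/2, written by cases to stay within ℕ without division; `triangle n`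
-- is n(n-1)/2.
exponent : ℕ → ℕ → ℤ → ℕ
exponent a b (+ n)    = a ℕ.* n ℕ.+ (a ℕ.+ b) ℕ.* triangle n
exponent a b -[1+ n ] = b ℕ.* suc n ℕ.+ (a ℕ.+ b) ℕ.* triangle (suc n)

2*triangle : ∀ n → + 2 ℤ.* + triangle n ≡ + n ℤ.* + n ℤ.- + n
2*triangle zero    = ≡.refl
2*triangle (suc n) = ≡.trans (ℤ.*-distribˡ-+ (+ 2) (+ n) (+ triangle n))
  (≡.trans (cong (λ x → + 2 ℤ.* + n ℤ.+ x) (2*triangle n)) (lemma (+ n)))
  where
  lemma : ∀ n → + 2 ℤ.* n ℤ.+ (n ℤ.* n ℤ.- n) ≡ (+ 1 ℤ.+ n) ℤ.* (+ 1 ℤ.+ n) ℤ.- (+ 1 ℤ.+ n)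
  lemma = solve-∀

2*exponent : ∀ a b k → + 2 ℤ.* + exponent a b k ≡ (+ a ℤ.+ + b) ℤ.* (k ℤ.* k) ℤ.+ (+ a ℤ.- + b) ℤ.* k
2*exponent a b (+ n) = begin
  + 2 ℤ.* + (a ℕ.* n ℕ.+ (a ℕ.+ b) ℕ.* triangle n)
    ≡⟨ cong (+ 2 ℤ.*_) (cong₂ ℤ._+_ (ℤ.pos-* a n) (ℤ.pos-* (a ℕ.+ b) (triangle n))) ⟩
  + 2 ℤ.* (+ a ℤ.* + n ℤ.+ (+ a ℤ.+ + b) ℤ.* + triangle n)
    ≡⟨ left (+ a) (+ b) (+ n) (+ triangle n) ⟩
  + 2 ℤ.* (+ a ℤ.* + n) ℤ.+ (+ a ℤ.+ + b) ℤ.* (+ 2 ℤ.* + triangle n)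
    ≡⟨ cong (λ x → + 2 ℤ.* (+ a ℤ.* + n) ℤ.+ (+ a ℤ.+ + b) ℤ.* x) (2*triangle n) ⟩
  + 2 ℤ.* (+ a ℤ.* + n) ℤ.+ (+ a ℤ.+ + b) ℤ.* (+ n ℤ.* + n ℤ.- + n)
    ≡⟨ right (+ a) (+ b) (+ n) ⟩
  (+ a ℤ.+ + b) ℤ.* (+ n ℤ.* + n) ℤ.+ (+ a ℤ.- + b) ℤ.* + n ∎
  where
  open ≡.≡-Reasoning
  left : ∀ a b n t → + 2 ℤ.* (a ℤ.* n ℤ.+ (a ℤ.+ b) ℤ.* t) ≡ + 2 ℤ.* (a ℤ.* n) ℤ.+ (a ℤ.+ b) ℤ.* (+ 2 ℤ.* t)
  left = solve-∀
  right : ∀ a b n → + 2 ℤ.* (a ℤ.* n) ℤ.+ (a ℤ.+ b) ℤ.* (n ℤ.* n ℤ.- n) ≡ (a ℤ.+ b) ℤ.* (n ℤ.* n) ℤ.+ (a ℤ.- b) ℤ.* n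
  right = solve-∀
2*exponent a b -[1+ n ] = begin
  + 2 ℤ.* + (b ℕ.* suc n ℕ.+ (a ℕ.+ b) ℕ.* triangle (suc n))
    ≡⟨ cong (λ m → + 2 ℤ.* + (b ℕ.* suc n ℕ.+ m ℕ.* triangle (suc n))) (ℕ.+-comm a b) ⟩
  + 2 ℤ.* + exponent b a (+ suc n)
    ≡⟨ 2*exponent b a (+ suc n) ⟩
  (+ b ℤ.+ + a) ℤ.* (+ suc n ℤ.* + suc n) ℤ.+ (+ b ℤ.- + a) ℤ.* + suc n
    ≡⟨ reflect-sign (+ a) (+ b) (+ suc n) ⟩
  (+ a ℤ.+ + b) ℤ.* (-[1+ n ] ℤ.* -[1+ n ]) ℤ.+ (+ a ℤ.- + b) ℤ.* -[1+ n ] ∎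
  where
  open ≡.≡-Reasoning
  reflect-sign : ∀ a b k → (b ℤ.+ a) ℤ.* (k ℤ.* k) ℤ.+ (b ℤ.- a) ℤ.* k
                         ≡ (a ℤ.+ b) ℤ.* ((ℤ.- k) ℤ.* (ℤ.- k)) ℤ.+ (a ℤ.- b) ℤ.* (ℤ.- k)
  reflect-sign = solve-∀

-- At least linear growth in |k|: this makes all theta terms with |k| ≥ K vanish.
∣k∣≤exponent : ∀ {a b} → 1 ℕ.≤ a → 1 ℕ.≤ b → ∀ k → ∣ k ∣ ℕ.≤ exponent a b k
∣k∣≤exponent (ℕ.s≤s {n = a} _) _ (+ n)    = ℕ.≤-trans (ℕ.m≤n*m n (suc a)) (ℕ.m≤m+n _ _)
∣k∣≤exponent _ (ℕ.s≤s {n = b} _) -[1+ n ] = ℕ.≤-trans (ℕ.m≤n*m (suc n) (suc b)) (ℕ.m≤m+n _ _)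

double-injective : ∀ {m n} → + 2 ℤ.* + m ≡ + 2 ℤ.* + n → m ≡ n
double-injective {m} {n} e = ℤ.+-injective (ℤ.*-cancelˡ-≡ (+ 2) (+ m) (+ n) e)

-- Equalities between exponents are verified after doubling, where 2*exponent is polynomial.
exponent-neg : ∀ a b k → exponent a b (ℤ.- k) ≡ exponent b a k
exponent-neg a b k = double-injective (begin
  + 2 ℤ.* + exponent a b (ℤ.- k)  ≡⟨ 2*exponent a b (ℤ.- k) ⟩
  _                               ≡⟨ lemma (+ a) (+ b) k ⟩
  _                               ≡⟨ 2*exponent b a k ⟨
  + 2 ℤ.* + exponent b a k        ∎)
  where
  open ≡.≡-Reasoning
  lemma : ∀ a b k → (a ℤ.+ b) ℤ.* ((ℤ.- k) ℤ.* (ℤ.- k)) ℤ.+ (a ℤ.- b) ℤ.* (ℤ.- k)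
                  ≡ (b ℤ.+ a) ℤ.* (k ℤ.* k) ℤ.+ (b ℤ.- a) ℤ.* k
  lemma = solve-∀

double-+ : ∀ {m n x y} → + 2 ℤ.* + m ≡ x → + 2 ℤ.* + n ≡ y → + 2 ℤ.* + (m ℕ.+ n) ≡ x ℤ.+ y
double-+ {m} {n} e f = ≡.trans (ℤ.*-distribˡ-+ (+ 2) (+ m) (+ n)) (cong₂ ℤ._+_ e f)

2*[exponent+exponent] : ∀ a b k c d l → + 2 ℤ.* + (exponent a b k ℕ.+ exponent c d l) ≡
  (+ a ℤ.+ + b) ℤ.* (k ℤ.* k) ℤ.+ (+ a ℤ.- + b) ℤ.* k ℤ.+ ((+ c ℤ.+ + d) ℤ.* (l ℤ.* l) ℤ.+ (+ c ℤ.- + d) ℤ.* l)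
2*[exponent+exponent] a b k c d l = double-+ {exponent a b k} (2*exponent a b k) (2*exponent c d l)

-- With b = a + r, the new pair is (3a + b, a + 3b); in the odd case it is (5a + 3b, b - a). Using r
-- instead of b keeps the difference b - a natural.
exponent-even : ∀ a r k → exponent a (a ℕ.+ r) (k ℤ.+ k)
              ≡ exponent (4 ℕ.* a ℕ.+ r) (4 ℕ.* a ℕ.+ 3 ℕ.* r) k
exponent-even a r k = double-injective (begin
  _ ≡⟨ 2*exponent a (a ℕ.+ r) (k ℤ.+ k) ⟩
  _ ≡⟨ lemma (+ a) (+ r) k ⟩
  _ ≡⟨ cong₂ (λ x y → (x ℤ.+ + r ℤ.+ (x ℤ.+ y)) ℤ.* (k ℤ.* k) ℤ.+ (x ℤ.+ + r ℤ.- (x ℤ.+ y)) ℤ.* k)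
         (ℤ.pos-* 4 a) (ℤ.pos-* 3 r) ⟨
  _ ≡⟨ 2*exponent (4 ℕ.* a ℕ.+ r) (4 ℕ.* a ℕ.+ 3 ℕ.* r) k ⟨
  _ ∎)
  where
  open ≡.≡-Reasoning
  lemma : ∀ a r k → (a ℤ.+ (a ℤ.+ r)) ℤ.* ((k ℤ.+ k) ℤ.* (k ℤ.+ k)) ℤ.+ (a ℤ.- (a ℤ.+ r)) ℤ.* (k ℤ.+ k)
    ≡ (+ 4 ℤ.* a ℤ.+ r ℤ.+ (+ 4 ℤ.* a ℤ.+ + 3 ℤ.* r)) ℤ.* (k ℤ.* k)
      ℤ.+ (+ 4 ℤ.* a ℤ.+ r ℤ.- (+ 4 ℤ.* a ℤ.+ + 3 ℤ.* r)) ℤ.* k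
  lemma = solve-∀

exponent-odd : ∀ a r k → exponent a (a ℕ.+ r) ((k ℤ.+ k) ℤ.+ (+ 1))
             ≡ a ℕ.+ exponent (8 ℕ.* a ℕ.+ 3 ℕ.* r) r k
exponent-odd a r k = double-injective (begin
  _ ≡⟨ 2*exponent a (a ℕ.+ r) ((k ℤ.+ k) ℤ.+ (+ 1)) ⟩
  _ ≡⟨ lemma (+ a) (+ r) k ⟩
  _ ≡⟨ cong₂ (λ x y → + 2 ℤ.* + a ℤ.+ ((x ℤ.+ y ℤ.+ + r) ℤ.* (k ℤ.* k) ℤ.+ (x ℤ.+ y ℤ.- + r) ℤ.* k))
         (ℤ.pos-* 8 a) (ℤ.pos-* 3 r) ⟨
  _ ≡⟨ double-+ {a} ≡.refl (2*exponent (8 ℕ.* a ℕ.+ 3 ℕ.* r) r k) ⟨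
  _ ∎)
  where
  open ≡.≡-Reasoning
  lemma : ∀ a r k → (a ℤ.+ (a ℤ.+ r)) ℤ.* (((k ℤ.+ k) ℤ.+ (+ 1)) ℤ.* ((k ℤ.+ k) ℤ.+ (+ 1)))
      ℤ.+ (a ℤ.- (a ℤ.+ r)) ℤ.* ((k ℤ.+ k) ℤ.+ (+ 1))
    ≡ + 2 ℤ.* a ℤ.+ ((+ 8 ℤ.* a ℤ.+ + 3 ℤ.* r ℤ.+ r) ℤ.* (k ℤ.* k) ℤ.+ (+ 8 ℤ.* a ℤ.+ + 3 ℤ.* r ℤ.- r) ℤ.* k)
  lemma = solve-∀

-- Both factors have the same modulus 2t + r + s, so (u - v)² and (u + v)² get equal coefficients
-- and the cross term u v cancels. The linear part is - 2r u - 2s v before halving, so the variables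
-- separate.
exponent-product-even : ∀ t r s u v →
  exponent (t ℕ.+ s) (t ℕ.+ r) (u ℤ.- v) ℕ.+ exponent t (t ℕ.+ r ℕ.+ s) (u ℤ.+ v)
  ≡ exponent (t ℕ.+ t ℕ.+ s) (t ℕ.+ t ℕ.+ r ℕ.+ r ℕ.+ s) u ℕ.+ exponent (t ℕ.+ t ℕ.+ r) (t ℕ.+ t ℕ.+ r ℕ.+ s ℕ.+ s) v
exponent-product-even t r s u v = double-injective (begin
  _ ≡⟨ 2*[exponent+exponent] (t ℕ.+ s) (t ℕ.+ r) (u ℤ.- v) t (t ℕ.+ r ℕ.+ s) (u ℤ.+ v) ⟩
  _ ≡⟨ lemma (+ t) (+ r) (+ s) u v ⟩
  _ ≡⟨ 2*[exponent+exponent] (t ℕ.+ t ℕ.+ s) (t ℕ.+ t ℕ.+ r ℕ.+ r ℕ.+ s) u (t ℕ.+ t ℕ.+ r) (t ℕ.+ t ℕ.+ r ℕ.+ s ℕ.+ s) v ⟨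
  _ ∎)
  where
  open ≡.≡-Reasoning
  lemma : ∀ t r s u v →
    ((t ℤ.+ s) ℤ.+ (t ℤ.+ r)) ℤ.* ((u ℤ.- v) ℤ.* (u ℤ.- v)) ℤ.+ ((t ℤ.+ s) ℤ.- (t ℤ.+ r)) ℤ.* (u ℤ.- v)
    ℤ.+ ((t ℤ.+ (t ℤ.+ r ℤ.+ s)) ℤ.* ((u ℤ.+ v) ℤ.* (u ℤ.+ v)) ℤ.+ (t ℤ.- (t ℤ.+ r ℤ.+ s)) ℤ.* (u ℤ.+ v))
    ≡ ((t ℤ.+ t ℤ.+ s) ℤ.+ (t ℤ.+ t ℤ.+ r ℤ.+ r ℤ.+ s)) ℤ.* (u ℤ.* u) ℤ.+ ((t ℤ.+ t ℤ.+ s) ℤ.- (t ℤ.+ t ℤ.+ r ℤ.+ r ℤ.+ s)) ℤ.* u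
    ℤ.+ (((t ℤ.+ t ℤ.+ r) ℤ.+ (t ℤ.+ t ℤ.+ r ℤ.+ s ℤ.+ s)) ℤ.* (v ℤ.* v) ℤ.+ ((t ℤ.+ t ℤ.+ r) ℤ.- (t ℤ.+ t ℤ.+ r ℤ.+ s ℤ.+ s)) ℤ.* v)
  lemma = solve-∀

exponent-product-odd : ∀ t r s u v →
  exponent (t ℕ.+ s) (t ℕ.+ r) (u ℤ.- v) ℕ.+ exponent t (t ℕ.+ r ℕ.+ s) ((u ℤ.+ v) ℤ.+ (+ 1))
  ≡ t ℕ.+ (exponent (4 ℕ.* t ℕ.+ s ℕ.+ s ℕ.+ r) r u ℕ.+ exponent (4 ℕ.* t ℕ.+ r ℕ.+ r ℕ.+ s) s v)
exponent-product-odd t r s u v = double-injective (begin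
  _ ≡⟨ 2*[exponent+exponent] (t ℕ.+ s) (t ℕ.+ r) (u ℤ.- v) t (t ℕ.+ r ℕ.+ s) ((u ℤ.+ v) ℤ.+ (+ 1)) ⟩
  _ ≡⟨ lemma (+ t) (+ r) (+ s) u v ⟩
  _ ≡⟨ cong (λ x → + 2 ℤ.* + t ℤ.+ (((x ℤ.+ + s ℤ.+ + s ℤ.+ + r) ℤ.+ + r) ℤ.* (u ℤ.* u) ℤ.+ ((x ℤ.+ + s ℤ.+ + s ℤ.+ + r) ℤ.- + r) ℤ.* u
          ℤ.+ (((x ℤ.+ + r ℤ.+ + r ℤ.+ + s) ℤ.+ + s) ℤ.* (v ℤ.* v) ℤ.+ ((x ℤ.+ + r ℤ.+ + r ℤ.+ + s) ℤ.- + s) ℤ.* v))) (ℤ.pos-* 4 t) ⟨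
  _ ≡⟨ double-+ {t} ≡.refl (2*[exponent+exponent] (4 ℕ.* t ℕ.+ s ℕ.+ s ℕ.+ r) r u (4 ℕ.* t ℕ.+ r ℕ.+ r ℕ.+ s) s v) ⟨
  _ ∎)
  where
  open ≡.≡-Reasoning
  lemma : ∀ t r s u v →
    ((t ℤ.+ s) ℤ.+ (t ℤ.+ r)) ℤ.* ((u ℤ.- v) ℤ.* (u ℤ.- v)) ℤ.+ ((t ℤ.+ s) ℤ.- (t ℤ.+ r)) ℤ.* (u ℤ.- v)
    ℤ.+ ((t ℤ.+ (t ℤ.+ r ℤ.+ s)) ℤ.* (((u ℤ.+ v) ℤ.+ (+ 1)) ℤ.* ((u ℤ.+ v) ℤ.+ (+ 1))) ℤ.+ (t ℤ.- (t ℤ.+ r ℤ.+ s)) ℤ.* ((u ℤ.+ v) ℤ.+ (+ 1)))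
    ≡ + 2 ℤ.* t ℤ.+ (((+ 4 ℤ.* t ℤ.+ s ℤ.+ s ℤ.+ r) ℤ.+ r) ℤ.* (u ℤ.* u) ℤ.+ ((+ 4 ℤ.* t ℤ.+ s ℤ.+ s ℤ.+ r) ℤ.- r) ℤ.* u
    ℤ.+ (((+ 4 ℤ.* t ℤ.+ r ℤ.+ r ℤ.+ s) ℤ.+ s) ℤ.* (v ℤ.* v) ℤ.+ ((+ 4 ℤ.* t ℤ.+ r ℤ.+ r ℤ.+ s) ℤ.- s) ℤ.* v))
  lemma = solve-∀

-- Passing from k to k + 1 raises the exponent by a + (a + b) k; the rest is n = j + k.
exponent-next : ∀ a b k n j → (+ j) ≡ + n ℤ.- k →
                (a ℕ.+ (a ℕ.+ b) ℕ.* n) ℕ.+ exponent a b k ≡ (a ℕ.+ b) ℕ.* j ℕ.+ exponent a b (k ℤ.+ (+ 1))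
exponent-next a b k n j e = double-injective (begin
  _ ≡⟨ double-+ {a ℕ.+ (a ℕ.+ b) ℕ.* n} (cong (λ x → + 2 ℤ.* (+ a ℤ.+ x)) (ℤ.pos-* (a ℕ.+ b) n)) (2*exponent a b k) ⟩
  _ ≡⟨ lemma (+ a) (+ b) k (+ n) ⟩
  _ ≡⟨ double-+ {(a ℕ.+ b) ℕ.* j} (cong (+ 2 ℤ.*_) (≡.trans (ℤ.pos-* (a ℕ.+ b) j) (cong ((+ a ℤ.+ + b) ℤ.*_) e))) (2*exponent a b (k ℤ.+ (+ 1))) ⟨
  _ ∎)
  where
  open ≡.≡-Reasoning
  lemma : ∀ a b k n → + 2 ℤ.* (a ℤ.+ (a ℤ.+ b) ℤ.* n) ℤ.+ ((a ℤ.+ b) ℤ.* (k ℤ.* k) ℤ.+ (a ℤ.- b) ℤ.* k)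
    ≡ + 2 ℤ.* ((a ℤ.+ b) ℤ.* (n ℤ.- k)) ℤ.+ ((a ℤ.+ b) ℤ.* ((k ℤ.+ (+ 1)) ℤ.* (k ℤ.+ (+ 1))) ℤ.+ (a ℤ.- b) ℤ.* (k ℤ.+ (+ 1)))
  lemma = solve-∀

-- Theta series with a nilpotent q.

NilpotentFrom : ∀ {c ℓ} (R : CommutativeRing c ℓ) → ℕ → CommutativeRing.Carrier R → Set ℓ
NilpotentFrom R K q = ∀ n → K ℕ.≤ n → q ^ n ≈ 0#
  where
  open CommutativeRing R
  open Exp semiring using (_^_)

module Theta {c ℓ} (R : CommutativeRing c ℓ) (q : CommutativeRing.Carrier R)
  (K : ℕ) (q^n≈0 : NilpotentFrom R K q) where

  open CommutativeRing R
  open Exp semiring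
  open import Relation.Binary.Reasoning.Setoid setoid
  open import Algebra.Properties.CommutativeSemigroup
    (CommutativeMonoid.commutativeSemigroup *-commutativeMonoid) using (interchange; x∙yz≈y∙xz)
  open BilateralSum R

  IsSign : Carrier → Set ℓ
  IsSign σ = σ * σ ≈ 1#

  1-isSign : IsSign 1#
  1-isSign = *-identityˡ 1#

  -- For a sign this is σ^k also at negative k, because σ is its own inverse.
  sign : Carrier → ℤ → Carrier
  sign σ k = σ ^ ∣ k ∣

  sign-next : ∀ {σ} → IsSign σ → ∀ k → sign σ (next k) ≈ σ * sign σ k
  sign-next σσ≈1 (+ n)        = refl
  sign-next σσ≈1 -[1+ zero  ] = sym (trans (*-congˡ (*-identityʳ _)) σσ≈1)
  sign-next σσ≈1 -[1+ suc n ] = sym (trans (sym (*-assoc _ _ _)) (trans (*-congʳ σσ≈1) (*-identityˡ _)))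

  sign-+1 : ∀ {σ} → IsSign σ → ∀ k → sign σ (k ℤ.+ (+ 1)) ≈ σ * sign σ k
  sign-+1 {σ} σσ≈1 k = trans (reflexive (cong (sign σ) (≡.sym (next≡+1 k)))) (sign-next σσ≈1 k)

  sign-neg : ∀ σ k → sign σ (ℤ.- k) ≈ sign σ k
  sign-neg σ k = ^-congʳ σ (ℤ.∣-i∣≡∣i∣ k)

  private
    sign-+⁺ : ∀ {σ} → IsSign σ → ∀ k n → sign σ (k ℤ.+ + n) ≈ sign σ k * sign σ (+ n)
    sign-+⁺ {σ} σσ≈1 k zero    = trans (reflexive (cong (sign σ) (ℤ.+-identityʳ k))) (sym (*-identityʳ _))
    sign-+⁺ {σ} σσ≈1 k (suc n) = begin
      sign σ (k ℤ.+ + suc n)           ≡⟨ cong (sign σ) (regroup k (+ n)) ⟩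
      sign σ ((k ℤ.+ + n) ℤ.+ (+ 1))   ≈⟨ sign-+1 σσ≈1 (k ℤ.+ + n) ⟩
      σ * sign σ (k ℤ.+ + n)           ≈⟨ *-congˡ (sign-+⁺ σσ≈1 k n) ⟩
      σ * (sign σ k * sign σ (+ n))    ≈⟨ x∙yz≈y∙xz _ _ _ ⟩
      sign σ k * sign σ (+ suc n)      ∎
      where
      regroup : ∀ k n → k ℤ.+ ((+ 1) ℤ.+ n) ≡ (k ℤ.+ n) ℤ.+ (+ 1)
      regroup = solve-∀

  sign-+ : ∀ {σ} → IsSign σ → ∀ k l → sign σ (k ℤ.+ l) ≈ sign σ k * sign σ l
  sign-+ σσ≈1 k (+ n) = sign-+⁺ σσ≈1 k n
  sign-+ {σ} σσ≈1 k -[1+ n ] = begin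
    sign σ (k ℤ.+ -[1+ n ])           ≈⟨ sign-neg σ (k ℤ.+ -[1+ n ]) ⟨
    sign σ (ℤ.- (k ℤ.+ -[1+ n ]))     ≡⟨ cong (sign σ) (ℤ.neg-distrib-+ k -[1+ n ]) ⟩
    sign σ ((ℤ.- k) ℤ.+ (+ suc n))    ≈⟨ sign-+⁺ σσ≈1 (ℤ.- k) (suc n) ⟩
    sign σ (ℤ.- k) * sign σ (+ suc n) ≈⟨ *-congʳ (sign-neg σ k) ⟩
    sign σ k * sign σ -[1+ n ]        ∎

  sign-double : ∀ {σ} → IsSign σ → ∀ k → sign σ (k ℤ.+ k) ≈ 1#
  sign-double {σ} σσ≈1 k = trans (sign-+ σσ≈1 k k) (square ∣ k ∣)
    where
    square : ∀ n → σ ^ n * σ ^ n ≈ 1#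
    square zero    = *-identityˡ 1#
    square (suc n) = trans (interchange _ _ _ _) (trans (*-cong σσ≈1 (square n)) (*-identityˡ 1#))

  sign-1 : ∀ k → sign 1# k ≈ 1#
  sign-1 k = 1^ ∣ k ∣
    where
    1^ : ∀ n → 1# ^ n ≈ 1#
    1^ zero    = refl
    1^ (suc n) = trans (*-identityˡ _) (1^ n)

  term : Carrier → ℕ → ℕ → ℤ → Carrier
  term σ a b k = sign σ k * q ^ exponent a b k

  term-1 : ∀ a b k → term 1# a b k ≈ q ^ exponent a b k
  term-1 a b k = trans (*-congʳ (sign-1 k)) (*-identityˡ _)

  term-supported : ∀ σ {a b} → 1 ℕ.≤ a → 1 ℕ.≤ b → SupportedIn K (term σ a b)
  term-supported σ 1≤a 1≤b k K≤k =
    trans (*-congˡ (q^n≈0 _ (ℕ.≤-trans K≤k (∣k∣≤exponent 1≤a 1≤b k)))) (zeroʳ _)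

  -- Ramanujan's f(σ q^a, σ q^b).
  θ : Carrier → ℕ → ℕ → Carrier
  θ σ a b = ∑ K (term σ a b)

  θ-∑ : ∀ σ {a b} → 1 ℕ.≤ a → 1 ℕ.≤ b → ∀ d → ∑ (K ℕ.+ d) (term σ a b) ≈ θ σ a b
  θ-∑ σ 1≤a 1≤b d = ∑-extend K d (term-supported σ 1≤a 1≤b)

  θ-∑*2 : ∀ σ {a b} → 1 ℕ.≤ a → 1 ℕ.≤ b → ∑ (K ℕ.* 2) (term σ a b) ≈ θ σ a b
  θ-∑*2 σ {a} {b} 1≤a 1≤b =
    trans (reflexive (cong (λ L → ∑ L (term σ a b)) K*2≡K+K)) (θ-∑ σ 1≤a 1≤b K)
    where
    K*2≡K+K : K ℕ.* 2 ≡ K ℕ.+ K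
    K*2≡K+K = ≡.trans (ℕ.*-comm K 2) (cong (K ℕ.+_) (ℕ.+-identityʳ K))

  term-neg : ∀ σ a b k → term σ a b (ℤ.- k) ≈ term σ b a k
  term-neg σ a b k = *-cong (sign-neg σ k) (^-congʳ q (exponent-neg a b k))

  θ-comm : ∀ σ {a b} → 1 ℕ.≤ a → 1 ℕ.≤ b → θ σ a b ≈ θ σ b a
  θ-comm σ {a} {b} 1≤a 1≤b = begin
    ∑ K (term σ a b)               ≈⟨ ∑-neg K (term-supported σ 1≤a 1≤b) ⟨
    ∑ K (λ k → term σ a b (ℤ.- k)) ≈⟨ ∑-cong′ K (term-neg σ a b) ⟩
    ∑ K (term σ b a)               ∎

  -- Terms with even index carry σ^(2k) = 1 and those with odd index σ^(2k+1) = σ, so the sign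
  -- survives only as a factor of the second theta.
  θ-dissection : ∀ {σ} → IsSign σ → ∀ a r → 1 ℕ.≤ a → 1 ℕ.≤ r →
    θ σ a (a ℕ.+ r) ≈ θ 1# (4 ℕ.* a ℕ.+ r) (4 ℕ.* a ℕ.+ 3 ℕ.* r)
                      + (σ * q ^ a) * θ 1# r (8 ℕ.* a ℕ.+ 3 ℕ.* r)
  θ-dissection {σ} σσ≈1 a r 1≤a 1≤r = begin
    θ σ a (a ℕ.+ r)
      ≈⟨ θ-∑*2 σ 1≤a (ℕ.m≤n⇒m≤n+o r 1≤a) ⟨
    ∑ (K ℕ.* 2) (term σ a (a ℕ.+ r))
      ≈⟨ ∑-parity K _ ⟩
    ∑ K (λ k → term σ a (a ℕ.+ r) (k ℤ.+ k)) + ∑ K (λ k → term σ a (a ℕ.+ r) ((k ℤ.+ k) ℤ.+ (+ 1)))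
      ≈⟨ +-cong (∑-cong′ K even) (∑-cong′ K odd) ⟩
    θ 1# (4 ℕ.* a ℕ.+ r) (4 ℕ.* a ℕ.+ 3 ℕ.* r)
      + ∑ K (λ k → (σ * q ^ a) * term 1# (8 ℕ.* a ℕ.+ 3 ℕ.* r) r k)
      ≈⟨ +-congˡ (∑-*ˡ K _ _) ⟨
    θ 1# (4 ℕ.* a ℕ.+ r) (4 ℕ.* a ℕ.+ 3 ℕ.* r) + (σ * q ^ a) * θ 1# (8 ℕ.* a ℕ.+ 3 ℕ.* r) r
      ≈⟨ +-congˡ (*-congˡ (θ-comm 1# (ℕ.m≤n⇒m≤n+o (3 ℕ.* r) (ℕ.≤-trans 1≤a (ℕ.m≤n*m a 8))) 1≤r)) ⟩
    θ 1# (4 ℕ.* a ℕ.+ r) (4 ℕ.* a ℕ.+ 3 ℕ.* r) + (σ * q ^ a) * θ 1# r (8 ℕ.* a ℕ.+ 3 ℕ.* r) ∎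
    where
    even : ∀ k → term σ a (a ℕ.+ r) (k ℤ.+ k) ≈ term 1# (4 ℕ.* a ℕ.+ r) (4 ℕ.* a ℕ.+ 3 ℕ.* r) k
    even k = *-cong (trans (sign-double σσ≈1 k) (sym (sign-1 k))) (^-congʳ q (exponent-even a r k))
    odd : ∀ k → term σ a (a ℕ.+ r) ((k ℤ.+ k) ℤ.+ (+ 1)) ≈ (σ * q ^ a) * term 1# (8 ℕ.* a ℕ.+ 3 ℕ.* r) r k
    odd k = begin
      sign σ ((k ℤ.+ k) ℤ.+ (+ 1)) * q ^ exponent a (a ℕ.+ r) ((k ℤ.+ k) ℤ.+ (+ 1))
        ≈⟨ *-cong (trans (sign-+1 σσ≈1 (k ℤ.+ k)) (trans (*-congˡ (sign-double σσ≈1 k)) (*-identityʳ σ)))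
                  (trans (^-congʳ q (exponent-odd a r k)) (^-homo-* q a _)) ⟩
      σ * (q ^ a * q ^ exponent (8 ℕ.* a ℕ.+ 3 ℕ.* r) r k)
        ≈⟨ *-assoc _ _ _ ⟨
      (σ * q ^ a) * q ^ exponent (8 ℕ.* a ℕ.+ 3 ℕ.* r) r k
        ≈⟨ *-congˡ (term-1 _ _ k) ⟨
      (σ * q ^ a) * term 1# (8 ℕ.* a ℕ.+ 3 ℕ.* r) r k ∎

  -- After the rotation the total sign has exponent 2u or 2u + 1, so both resulting products are
  -- unsigned and σ remains only in front of the second. Giving the index u + v (+ 1) to the factor
  -- with the parameter t makes the odd case contribute q^t.
  θ-product : ∀ {σ} → IsSign σ → ∀ t r s → 1 ℕ.≤ t → 1 ℕ.≤ r → 1 ℕ.≤ s →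
    θ σ t (t ℕ.+ r ℕ.+ s) * θ σ (t ℕ.+ s) (t ℕ.+ r) ≈
      θ 1# (t ℕ.+ t ℕ.+ s) (t ℕ.+ t ℕ.+ r ℕ.+ r ℕ.+ s) * θ 1# (t ℕ.+ t ℕ.+ r) (t ℕ.+ t ℕ.+ r ℕ.+ s ℕ.+ s)
      + (σ * q ^ t) * (θ 1# r (4 ℕ.* t ℕ.+ s ℕ.+ s ℕ.+ r) * θ 1# s (4 ℕ.* t ℕ.+ r ℕ.+ r ℕ.+ s))
  θ-product {σ} σσ≈1 t r s 1≤t 1≤r 1≤s = begin
    θ σ t (t ℕ.+ r ℕ.+ s) * θ σ (t ℕ.+ s) (t ℕ.+ r)
      ≈⟨ *-comm _ _ ⟩
    θ σ (t ℕ.+ s) (t ℕ.+ r) * θ σ t (t ℕ.+ r ℕ.+ s)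
      ≈⟨ trans (∑-*ʳ K _ _) (∑-cong′ K (λ i → ∑-*ˡ K _ _)) ⟩
    ∑ K (λ i → ∑ K (h i))
      ≈⟨ ∑∑-rotate K h
           (λ i j K≤j → trans (*-congˡ (term-supported σ 1≤t (1≤+ s (1≤+ r 1≤t)) j K≤j)) (zeroʳ _))
           (λ j i K≤i → trans (*-congʳ (term-supported σ (1≤+ s 1≤t) (1≤+ r 1≤t) i K≤i)) (zeroˡ _)) ⟩
    ∑ K (λ v → ∑ (K ℕ.* 2) (λ u → h (u ℤ.- v) (u ℤ.+ v)))
      + ∑ K (λ v → ∑ (K ℕ.* 2) (λ u → h (u ℤ.- v) ((u ℤ.+ v) ℤ.+ (+ 1))))
      ≈⟨ +-cong (∑-cong′ K (λ v → ∑-cong′ (K ℕ.* 2) (λ u → even u v)))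
                (∑-cong′ K (λ v → ∑-cong′ (K ℕ.* 2) (λ u → odd u v))) ⟩
    ∑ K (λ v → ∑ (K ℕ.* 2) (λ u → term 1# A B u * term 1# C D v))
      + ∑ K (λ v → ∑ (K ℕ.* 2) (λ u → (σ * q ^ t) * (term 1# A′ r u * term 1# C′ s v)))
      ≈⟨ +-congˡ (trans (∑-*ˡ K _ _) (∑-cong′ K (λ v → ∑-*ˡ (K ℕ.* 2) _ _))) ⟨
    ∑ K (λ v → ∑ (K ℕ.* 2) (λ u → term 1# A B u * term 1# C D v))
      + (σ * q ^ t) * ∑ K (λ v → ∑ (K ℕ.* 2) (λ u → term 1# A′ r u * term 1# C′ s v))
      ≈⟨ +-cong (separate (1≤+ s (1≤+ t 1≤t)) (1≤+ s (1≤+ r (1≤+ r (1≤+ t 1≤t)))))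
                (*-congˡ (trans (separate 1≤A′ 1≤r) (*-cong (θ-comm 1# 1≤A′ 1≤r) (θ-comm 1# 1≤C′ 1≤s)))) ⟩
    θ 1# A B * θ 1# C D + (σ * q ^ t) * (θ 1# r A′ * θ 1# s C′) ∎
    where
    A B C D A′ C′ : ℕ
    A  = t ℕ.+ t ℕ.+ s
    B  = t ℕ.+ t ℕ.+ r ℕ.+ r ℕ.+ s
    C  = t ℕ.+ t ℕ.+ r
    D  = t ℕ.+ t ℕ.+ r ℕ.+ s ℕ.+ s
    A′ = 4 ℕ.* t ℕ.+ s ℕ.+ s ℕ.+ r
    C′ = 4 ℕ.* t ℕ.+ r ℕ.+ r ℕ.+ s

    1≤+ : ∀ {m} n → 1 ℕ.≤ m → 1 ℕ.≤ m ℕ.+ n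
    1≤+ n = ℕ.m≤n⇒m≤n+o n

    1≤A′ : 1 ℕ.≤ A′
    1≤A′ = 1≤+ r (1≤+ s (1≤+ s (ℕ.≤-trans 1≤t (ℕ.m≤n*m t 4))))
    1≤C′ : 1 ℕ.≤ C′
    1≤C′ = 1≤+ s (1≤+ r (1≤+ r (ℕ.≤-trans 1≤t (ℕ.m≤n*m t 4))))

    h : ℤ → ℤ → Carrier
    h i j = term σ (t ℕ.+ s) (t ℕ.+ r) i * term σ t (t ℕ.+ r ℕ.+ s) j

    sign-even : ∀ u v → sign σ (u ℤ.- v) * sign σ (u ℤ.+ v) ≈ 1#
    sign-even u v = begin
      sign σ (u ℤ.- v) * sign σ (u ℤ.+ v) ≈⟨ sign-+ σσ≈1 (u ℤ.- v) (u ℤ.+ v) ⟨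
      sign σ ((u ℤ.- v) ℤ.+ (u ℤ.+ v))    ≡⟨ cong (sign σ) (cancel u v) ⟩
      sign σ (u ℤ.+ u)                    ≈⟨ sign-double σσ≈1 u ⟩
      1#                                  ∎
      where
      cancel : ∀ u v → (u ℤ.- v) ℤ.+ (u ℤ.+ v) ≡ u ℤ.+ u
      cancel = solve-∀

    sign-odd : ∀ u v → sign σ (u ℤ.- v) * sign σ ((u ℤ.+ v) ℤ.+ (+ 1)) ≈ σ
    sign-odd u v = begin
      sign σ (u ℤ.- v) * sign σ ((u ℤ.+ v) ℤ.+ (+ 1)) ≈⟨ *-congˡ (sign-+1 σσ≈1 (u ℤ.+ v)) ⟩
      sign σ (u ℤ.- v) * (σ * sign σ (u ℤ.+ v))       ≈⟨ x∙yz≈y∙xz _ _ _ ⟩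
      σ * (sign σ (u ℤ.- v) * sign σ (u ℤ.+ v))       ≈⟨ *-congˡ (sign-even u v) ⟩
      σ * 1#                                          ≈⟨ *-identityʳ σ ⟩
      σ                                               ∎

    even : ∀ u v → h (u ℤ.- v) (u ℤ.+ v) ≈ term 1# A B u * term 1# C D v
    even u v = begin
      h (u ℤ.- v) (u ℤ.+ v)
        ≈⟨ interchange _ _ _ _ ⟩
      _ ≈⟨ *-cong (sign-even u v) (trans (sym (^-homo-* q (exponent (t ℕ.+ s) (t ℕ.+ r) (u ℤ.- v)) _)) (^-congʳ q (exponent-product-even t r s u v))) ⟩
      1# * q ^ (exponent A B u ℕ.+ exponent C D v)
        ≈⟨ trans (*-identityˡ _) (^-homo-* q (exponent A B u) _) ⟩
      q ^ exponent A B u * q ^ exponent C D v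
        ≈⟨ *-cong (term-1 A B u) (term-1 C D v) ⟨
      term 1# A B u * term 1# C D v ∎

    odd : ∀ u v → h (u ℤ.- v) ((u ℤ.+ v) ℤ.+ (+ 1)) ≈ (σ * q ^ t) * (term 1# A′ r u * term 1# C′ s v)
    odd u v = begin
      h (u ℤ.- v) ((u ℤ.+ v) ℤ.+ (+ 1))
        ≈⟨ interchange _ _ _ _ ⟩
      _ ≈⟨ *-cong (sign-odd u v) (trans (sym (^-homo-* q (exponent (t ℕ.+ s) (t ℕ.+ r) (u ℤ.- v)) _)) (^-congʳ q (exponent-product-odd t r s u v))) ⟩
      σ * q ^ (t ℕ.+ (exponent A′ r u ℕ.+ exponent C′ s v))
        ≈⟨ *-congˡ (trans (^-homo-* q t _) (*-congˡ (^-homo-* q (exponent A′ r u) _))) ⟩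
      σ * (q ^ t * (q ^ exponent A′ r u * q ^ exponent C′ s v))
        ≈⟨ *-assoc _ _ _ ⟨
      (σ * q ^ t) * (q ^ exponent A′ r u * q ^ exponent C′ s v)
        ≈⟨ *-congˡ (*-cong (term-1 A′ r u) (term-1 C′ s v)) ⟨
      (σ * q ^ t) * (term 1# A′ r u * term 1# C′ s v) ∎

    separate : ∀ {a b c d} → 1 ℕ.≤ a → 1 ℕ.≤ b →
      ∑ K (λ v → ∑ (K ℕ.* 2) (λ u → term 1# a b u * term 1# c d v)) ≈ θ 1# a b * θ 1# c d
    separate 1≤a 1≤b = trans
      (∑-cong′ K (λ v → trans (sym (∑-*ʳ (K ℕ.* 2) _ _)) (*-congʳ (θ-∑*2 1# 1≤a 1≤b))))
      (sym (∑-*ˡ K _ _))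

-- The Jacobi triple product.

+N-[1+p]-negative : ∀ N p → N ℕ.≤ p → ∃ λ n → + N ℤ.+ -[1+ p ] ≡ -[1+ n ]
+N-[1+p]-negative zero    p       _           = p , ≡.refl
+N-[1+p]-negative (suc N) (suc p) (ℕ.s≤s N≤p) =
  let n , e = +N-[1+p]-negative N p N≤p in n , ≡.trans (ℤ.[1+m]⊖[1+n]≡m⊖n N (suc p)) e

-- The reason for taking the finite triple product at N = M = 2K: for |j| ≤ K the index 2K + j stays
-- where `recipQfac` no longer changes.
+[K+K]+j-large : ∀ K j → ∣ j ∣ ℕ.≤ K → ∃ λ d → + (K ℕ.+ K) ℤ.+ j ≡ + (K ℕ.+ d)
+[K+K]+j-large K (+ n)    _   = K ℕ.+ n , cong +_ (ℕ.+-assoc K K n)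
+[K+K]+j-large K -[1+ p ] p<K = K ℕ.∸ suc p ,
  ≡.trans (ℤ.⊖-≥ (ℕ.≤-trans p<K (ℕ.m≤m+n K K))) (cong +_ (ℕ.+-∸-assoc K p<K))

module TripleProduct {c ℓ} (R : CommutativeRing c ℓ) (q : CommutativeRing.Carrier R)
  (K : ℕ) (q^n≈0 : NilpotentFrom R K q) where

  open CommutativeRing R
  open Theta R q K q^n≈0
  open Exp semiring
  open import Relation.Binary.Reasoning.Setoid setoid
  open import Algebra.Properties.CommutativeSemigroup
    (CommutativeMonoid.commutativeSemigroup *-commutativeMonoid) using (interchange; x∙yz≈y∙xz)
  open BilateralSum R
  open SemiringSolver commutativeSemiring using (solve; _:=_; _:+_; _:*_; con)

  open FiniteFold *-commutativeMonoid public using () renaming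
    (fold to ∏; fold-cong to ∏-cong; fold-cong′ to ∏-cong′; fold-∙ to ∏-*; fold-last to ∏-last;
     fold-ε to ∏-1; fold-extend to ∏-extend; fold-block to ∏-block; fold-swap to ∏-swap)

  +-cancelʳ : ∀ {x y} z → x + z ≈ y + z → x ≈ y
  +-cancelʳ z = GroupProperties.∙-cancelʳ +-group z _ _

  x+0* : ∀ {x y} z → y ≈ 0# → x + z * y ≈ x
  x+0* z y≈0 = trans (+-congˡ (trans (*-congˡ y≈0) (zeroʳ z))) (+-identityʳ _)

  -- The step that removes a difference 1 - x, after x times the other factor has been added to both
  -- sides of an equation.
  1-x+x : ∀ x → (1# + - 1# * x) + x ≈ 1#
  1-x+x x = begin
    (1# + - 1# * x) + x  ≈⟨ +-congʳ (+-congˡ (RingProperties.-1*x≈-x ring x)) ⟩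
    (1# + - x) + x       ≈⟨ trans (+-assoc _ _ _) (+-congˡ (-‿inverseˡ x)) ⟩
    1# + 0#              ≈⟨ +-identityʳ 1# ⟩
    1#                   ∎

  -1-isSign : IsSign (- 1#)
  -1-isSign = trans (RingProperties.-1*x≈-x ring (- 1#)) (GroupProperties.⁻¹-involutive +-group 1#)

  geometric : ℕ → ℕ → Carrier
  geometric zero    j = 0#
  geometric (suc n) j = 1# + q ^ j * geometric n j

  -- The inverse of 1 - q^j for j ≥ 1: K terms of the geometric series suffice, since the remainder
  -- q^(jK) is zero.
  recip : ℕ → Carrier
  recip j = geometric K j

  recip-unfold : ∀ j → 1 ℕ.≤ j → recip j ≈ 1# + q ^ j * recip j
  recip-unfold j@(suc _) _ = begin
    geometric K j                 ≈⟨ +-identityʳ _ ⟨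
    geometric K j + 0#            ≈⟨ +-congˡ (trans (^-assocʳ q j K) (q^n≈0 _ (ℕ.m≤n*m K j))) ⟨
    geometric K j + (q ^ j) ^ K   ≈⟨ telescope K ⟩
    1# + q ^ j * geometric K j    ∎
    where
    telescope : ∀ n → geometric n j + (q ^ j) ^ n ≈ 1# + q ^ j * geometric n j
    telescope zero    = trans (+-identityˡ _) (sym (trans (+-congˡ (zeroʳ _)) (+-identityʳ _)))
    telescope (suc n) = begin
      (1# + q ^ j * geometric n j) + q ^ j * (q ^ j) ^ n
        ≈⟨ trans (+-assoc _ _ _) (+-congˡ (sym (distribˡ _ _ _))) ⟩
      1# + q ^ j * (geometric n j + (q ^ j) ^ n)
        ≈⟨ +-congˡ (*-congˡ (telescope n)) ⟩
      1# + q ^ j * geometric (suc n) j ∎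

  recip-inverse : ∀ j → 1 ℕ.≤ j → (1# + - 1# * q ^ j) * recip j ≈ 1#
  recip-inverse j 1≤j = +-cancelʳ (q ^ j * recip j) (begin
    (1# + - 1# * q ^ j) * recip j + q ^ j * recip j  ≈⟨ distribʳ _ _ _ ⟨
    ((1# + - 1# * q ^ j) + q ^ j) * recip j          ≈⟨ *-congʳ (1-x+x (q ^ j)) ⟩
    1# * recip j                                     ≈⟨ *-identityˡ _ ⟩
    recip j                                          ≈⟨ recip-unfold j 1≤j ⟩
    1# + q ^ j * recip j                             ∎)

  -- The q-shifted factorial (- σ q^r ; q^m)_n.
  poch : Carrier → ℕ → ℕ → ℕ → Carrier
  poch σ r m n = ∏ n (λ i → 1# + σ * q ^ (r ℕ.+ i ℕ.* m))

  -- Factors with i ≥ K equal 1, as r + i m ≥ K. Thus `poch σ r m K` plays the role of the infinite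
  -- product.
  poch-stable : ∀ σ r m → 1 ℕ.≤ r → 1 ℕ.≤ m → ∀ d → poch σ r m (K ℕ.+ d) ≈ poch σ r m K
  poch-stable σ r m@(suc _) _ _ d = ∏-extend K d (λ i K≤i → x+0* σ
    (q^n≈0 _ (ℕ.≤-trans K≤i (ℕ.≤-trans (ℕ.m≤m*n i m) (ℕ.m≤n+m _ r)))))

  module _ (m : ℕ) (1≤m : 1 ℕ.≤ m) where

    -- (q^m ; q^m)_n and its reciprocal; the latter is extended by zero to negative n, so that
    -- the Gaussian binomial coefficients below vanish outside their range.
    qfac : ℕ → Carrier
    qfac n = poch (- 1#) m m n

    recipQfac : ℤ → Carrier
    recipQfac (+ n)    = ∏ n (λ i → recip (m ℕ.+ i ℕ.* m))
    recipQfac -[1+ n ] = 0#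

    -- q^(m k); the default 0 at negative k is harmless, because `power` is always multiplied by
    -- `recipQfac` at the same argument.
    power : ℤ → Carrier
    power (+ n)    = q ^ (n ℕ.* m)
    power -[1+ n ] = 0#

    1≤m+ : ∀ n → 1 ℕ.≤ m ℕ.+ n
    1≤m+ n = ℕ.m≤n⇒m≤n+o n 1≤m

    qfac-suc : ∀ n → qfac (suc n) + q ^ (suc n ℕ.* m) * qfac n ≈ qfac n
    qfac-suc n = begin
      qfac (suc n) + x * qfac n                ≈⟨ +-congʳ (∏-last n _) ⟩
      qfac n * (1# + - 1# * x) + x * qfac n    ≈⟨ +-congʳ (*-comm _ _) ⟩
      (1# + - 1# * x) * qfac n + x * qfac n    ≈⟨ distribʳ _ _ _ ⟨
      ((1# + - 1# * x) + x) * qfac n           ≈⟨ *-congʳ (1-x+x x) ⟩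
      1# * qfac n                              ≈⟨ *-identityˡ _ ⟩
      qfac n                                   ∎
      where
      x : Carrier
      x = q ^ (suc n ℕ.* m)

    -- The relation 1/(q^m;q^m)_k = (1 - q^(m(k+1))) / (q^m;q^m)_(k+1) at every integer k. At k = -1
    -- the factor 1 - q^0 is zero, in accordance with the extension by zero.
    recipQfac-next : ∀ k → recipQfac k + power (next k) * recipQfac (next k) ≈ recipQfac (next k)
    recipQfac-next (+ n) = begin
      x + y * recipQfac (+ suc n)    ≈⟨ +-congˡ (*-congˡ (∏-last n _)) ⟩
      x + y * (x * g)                ≈⟨ factor x y g ⟩
      x * (1# + y * g)               ≈⟨ *-congˡ (recip-unfold _ (1≤m+ _)) ⟨
      x * g                          ≈⟨ ∏-last n _ ⟨
      recipQfac (+ suc n)            ∎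
      where
      x y g : Carrier
      x = recipQfac (+ n)
      y = q ^ (suc n ℕ.* m)
      g = recip (suc n ℕ.* m)
      factor : ∀ x y g → x + y * (x * g) ≈ x * (1# + y * g)
      factor = solve 3 (λ x y g → x :+ y :* (x :* g) := x :* (con 1 :+ y :* g)) refl
    recipQfac-next -[1+ zero  ] = trans (+-identityˡ _) (*-identityˡ _)
    recipQfac-next -[1+ suc n ] = trans (+-identityˡ _) (zeroʳ _)

    -- The law of exponents for x, y ≥ 0; otherwise a reciprocal factorial makes both sides zero.
    power-+ : ∀ x y n → x ℤ.+ y ≡ + n →
      (power x * power y) * (recipQfac x * recipQfac y) ≈ q ^ (n ℕ.* m) * (recipQfac x * recipQfac y)
    power-+ (+ i) (+ j) n e = *-congʳ (trans (sym (^-homo-* q (i ℕ.* m) (j ℕ.* m)))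
      (^-congʳ q (≡.trans (≡.sym (ℕ.*-distribʳ-+ m i j)) (cong (ℕ._* m) (ℤ.+-injective e)))))
    power-+ (+ i) -[1+ j ] n e = trans (trans (*-congˡ (zeroʳ _)) (zeroʳ _)) (sym (trans (*-congˡ (zeroʳ _)) (zeroʳ _)))
    power-+ -[1+ i ] y n e = trans (trans (*-congˡ (zeroˡ _)) (zeroʳ _)) (sym (trans (*-congˡ (zeroˡ _)) (zeroʳ _)))

    qfac-inverse : ∀ n → qfac n * recipQfac (+ n) ≈ 1#
    qfac-inverse n = begin
      qfac n * recipQfac (+ n)
        ≈⟨ ∏-* n _ _ ⟨
      ∏ n (λ i → (1# + - 1# * q ^ (m ℕ.+ i ℕ.* m)) * recip (m ℕ.+ i ℕ.* m))
        ≈⟨ ∏-cong′ n (λ i → recip-inverse _ (1≤m+ _)) ⟩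
      ∏ n (λ _ → 1#)
        ≈⟨ ∏-1 n ⟩
      1# ∎

    recipQfac-stable : ∀ d → recipQfac (+ (K ℕ.+ d)) ≈ recipQfac (+ K)
    recipQfac-stable d = begin
      r′                   ≈⟨ *-identityˡ r′ ⟨
      1# * r′              ≈⟨ *-congʳ (qfac-inverse K) ⟨
      (qfac K * r) * r′    ≈⟨ *-congʳ (*-congʳ (poch-stable (- 1#) m m 1≤m 1≤m d)) ⟨
      (qfac (K ℕ.+ d) * r) * r′ ≈⟨ swap (qfac (K ℕ.+ d)) r r′ ⟩
      (qfac (K ℕ.+ d) * r′) * r ≈⟨ *-congʳ (qfac-inverse (K ℕ.+ d)) ⟩
      1# * r               ≈⟨ *-identityˡ r ⟩
      r                    ∎
      where
      r r′ : Carrier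
      r  = recipQfac (+ K)
      r′ = recipQfac (+ (K ℕ.+ d))
      swap : ∀ x y z → (x * y) * z ≈ (x * z) * y
      swap = solve 3 (λ x y z → (x :* y) :* z := (x :* z) :* y) refl

    -- (q^m;q^m)_{N+M} / ((q^m;q^m)_{N-k} (q^m;q^m)_{M+k}) times the k-th term of θ σ a b.
    summand : Carrier → ℕ → ℕ → ℕ → ℕ → ℤ → Carrier
    summand σ a b N M k =
      (qfac (N ℕ.+ M) * (recipQfac (+ N ℤ.- k) * recipQfac (+ M ℤ.+ k))) * term σ a b k

    summand-supported : ∀ σ a b N M → SupportedIn (suc (N ℕ.+ M)) (summand σ a b N M)
    summand-supported σ a b N M k N+M<k =
      trans (*-congʳ (trans (*-congˡ (vanish k N+M<k)) (zeroʳ _))) (zeroˡ _)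
      where
      vanish : ∀ k → suc (N ℕ.+ M) ℕ.≤ ∣ k ∣ → recipQfac (+ N ℤ.- k) * recipQfac (+ M ℤ.+ k) ≈ 0#
      vanish (+ suc p) (ℕ.s≤s N+M≤p) =
        trans (*-congʳ (reflexive (cong recipQfac (proj₂ (+N-[1+p]-negative N p (ℕ.m+n≤o⇒m≤o N N+M≤p)))))) (zeroˡ _)
      vanish -[1+ p ] (ℕ.s≤s N+M≤p) =
        trans (*-congˡ (reflexive (cong recipQfac (proj₂ (+N-[1+p]-negative M p (ℕ.m+n≤o⇒n≤o N N+M≤p)))))) (zeroʳ _)

    module _ {σ} (σσ≈1 : IsSign σ) where

      -- By `exponent-next`, with j = N - k. The common factor `recipQfac` disposes of the case N -
      -- k < 0, where `power` is not a power of q.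
      term-next : ∀ a b → a ℕ.+ b ≡ m → ∀ N k →
        ((σ * q ^ (a ℕ.+ N ℕ.* m)) * term σ a b k) * recipQfac (+ N ℤ.- k)
        ≈ (power (+ N ℤ.- k) * term σ a b (k ℤ.+ (+ 1))) * recipQfac (+ N ℤ.- k)
      term-next a b ≡.refl N k with + N ℤ.- k in e
      ... | -[1+ _ ] = trans (zeroʳ _) (sym (zeroʳ _))
      ... | + j      = *-congʳ (begin
        (σ * q ^ (a ℕ.+ N ℕ.* m)) * (sign σ k * q ^ exponent a b k)
          ≈⟨ interchange _ _ _ _ ⟩
        (σ * sign σ k) * (q ^ (a ℕ.+ N ℕ.* m) * q ^ exponent a b k)
          ≈⟨ *-cong (sign-+1 σσ≈1 k) (^-homo-* q (a ℕ.+ N ℕ.* m) _) ⟨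
        sign σ (k ℤ.+ (+ 1)) * q ^ (a ℕ.+ N ℕ.* m ℕ.+ exponent a b k)
          ≈⟨ *-congˡ (trans (^-congʳ q exponents) (^-homo-* q (j ℕ.* m) _)) ⟩
        sign σ (k ℤ.+ (+ 1)) * (q ^ (j ℕ.* m) * q ^ exponent a b (k ℤ.+ (+ 1)))
          ≈⟨ x∙yz≈y∙xz _ _ _ ⟩
        q ^ (j ℕ.* m) * term σ a b (k ℤ.+ (+ 1)) ∎)
        where
        exponents : a ℕ.+ N ℕ.* m ℕ.+ exponent a b k ≡ j ℕ.* m ℕ.+ exponent a b (k ℤ.+ (+ 1))
        exponents = ≡.trans (cong (λ x → a ℕ.+ x ℕ.+ exponent a b k) (ℕ.*-comm N m))
          (≡.trans (exponent-next a b k N j (≡.sym e)) (cong (ℕ._+ exponent a b (k ℤ.+ (+ 1))) (ℕ.*-comm m j)))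

      -- The q-Pascal rule, base q^m: [N+M+1, N-k] = [N+M, N-k-1] + q^(m(N-k)) [N+M, N-k]. By
      -- `term-next` the power q^(m(N-k)) turns the term at k + 1 into σ q^(a+Nm) times the term at
      -- k.
      summand-suc : ∀ a b → a ℕ.+ b ≡ m → ∀ N M k →
        summand σ a b (suc N) M (k ℤ.+ (+ 1)) ≈
          summand σ a b N M (k ℤ.+ (+ 1)) + (σ * q ^ (a ℕ.+ N ℕ.* m)) * summand σ a b N M k
      summand-suc a b a+b≡m N M k = begin
        summand σ a b (suc N) M (k ℤ.+ (+ 1))
          ≡⟨ cong (λ z → (c′ * (recipQfac z * iy)) * t) (shift-index (+ N) k) ⟩
        (c′ * (ix * iy)) * t
          ≈⟨ pascal {c = qfac (N ℕ.+ M)} {c′} {ix} {ix′} {iy} {iy′} {t} {term σ a b k}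
               {σ * q ^ (a ℕ.+ N ℕ.* m)} {power x} {power y} {q ^ (suc (N ℕ.+ M) ℕ.* m)}
               (qfac-suc (N ℕ.+ M)) recip-x recip-y (term-next a b a+b≡m N k)
               (power-+ x y (suc (N ℕ.+ M)) x+y) ⟩
        summand σ a b N M (k ℤ.+ (+ 1)) + (σ * q ^ (a ℕ.+ N ℕ.* m)) * summand σ a b N M k ∎
        where
        x y : ℤ
        x = + N ℤ.- k
        y = + M ℤ.+ (k ℤ.+ (+ 1))
        c′ ix ix′ iy iy′ t : Carrier
        c′  = qfac (suc N ℕ.+ M)
        ix  = recipQfac x
        ix′ = recipQfac (+ N ℤ.- (k ℤ.+ (+ 1)))
        iy  = recipQfac y
        iy′ = recipQfac (+ M ℤ.+ k)
        t   = term σ a b (k ℤ.+ (+ 1))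

        shift-index : ∀ n k → (+ 1 ℤ.+ n) ℤ.- (k ℤ.+ (+ 1)) ≡ n ℤ.- k
        shift-index = solve-∀
        x+y : x ℤ.+ y ≡ + suc (N ℕ.+ M)
        x+y = regroup (+ N) (+ M) k
          where
          regroup : ∀ n m k → (n ℤ.- k) ℤ.+ (m ℤ.+ (k ℤ.+ (+ 1))) ≡ + 1 ℤ.+ (n ℤ.+ m)
          regroup = solve-∀

        next-x : next (+ N ℤ.- (k ℤ.+ (+ 1))) ≡ x
        next-x = ≡.trans (next≡+1 _) (lemma (+ N) k)
          where
          lemma : ∀ n k → (n ℤ.- (k ℤ.+ (+ 1))) ℤ.+ (+ 1) ≡ n ℤ.- k
          lemma = solve-∀
        next-y : next (+ M ℤ.+ k) ≡ y
        next-y = ≡.trans (next≡+1 _) (ℤ.+-assoc (+ M) k (+ 1))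

        recip-x : ix′ + power x * ix ≈ ix
        recip-x = subst (λ z → ix′ + power z * recipQfac z ≈ recipQfac z) next-x (recipQfac-next (+ N ℤ.- (k ℤ.+ (+ 1))))
        recip-y : iy′ + power y * iy ≈ iy
        recip-y = subst (λ z → iy′ + power z * recipQfac z ≈ recipQfac z) next-y (recipQfac-next (+ M ℤ.+ k))

        -- With X = q^(m(N-k)), Y = q^(m(M+k+1)) and w = X Y this is 1 - w = (1 - X) + X (1 - Y),
        -- multiplied by factorials and with the w term added on both sides.
        pascal : ∀ {c c′ ix ix′ iy iy′ t t′ s X Y w} →
          c′ + w * c ≈ c → ix′ + X * ix ≈ ix → iy′ + Y * iy ≈ iy →
          (s * t′) * ix ≈ (X * t) * ix → (X * Y) * (ix * iy) ≈ w * (ix * iy) →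
          (c′ * (ix * iy)) * t ≈ (c * (ix′ * iy)) * t + s * ((c * (ix * iy′)) * t′)
        pascal {c} {c′} {ix} {ix′} {iy} {iy′} {t} {t′} {s} {X} {Y} {w} hc hx hy ht hw =
          +-cancelʳ (w * (c * (ix * iy) * t)) (begin
            c′ * (ix * iy) * t + w * (c * (ix * iy) * t)
              ≈⟨ solve 6 (λ c c′ ix iy t w → c′ :* (ix :* iy) :* t :+ w :* (c :* (ix :* iy) :* t)
                    := (c′ :+ w :* c) :* (ix :* iy) :* t) refl c c′ ix iy t w ⟩
            (c′ + w * c) * (ix * iy) * t
              ≈⟨ *-congʳ (*-congʳ hc) ⟩
            c * (ix * iy) * t
              ≈⟨ *-congʳ (*-congˡ (*-congʳ hx)) ⟨
            c * ((ix′ + X * ix) * iy) * t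
              ≈⟨ solve 6 (λ c ix ix′ iy t X → c :* ((ix′ :+ X :* ix) :* iy) :* t
                    := c :* (ix′ :* iy) :* t :+ c :* X :* ix :* t :* iy) refl c ix ix′ iy t X ⟩
            c * (ix′ * iy) * t + c * X * ix * t * iy
              ≈⟨ +-congˡ (*-congˡ hy) ⟨
            c * (ix′ * iy) * t + c * X * ix * t * (iy′ + Y * iy)
              ≈⟨ solve 8 (λ c ix ix′ iy iy′ t X Y → c :* (ix′ :* iy) :* t :+ c :* X :* ix :* t :* (iy′ :+ Y :* iy)
                    := c :* (ix′ :* iy) :* t :+ (c :* iy′ :* (X :* t :* ix) :+ c :* t :* (X :* Y :* (ix :* iy))))
                    refl c ix ix′ iy iy′ t X Y ⟩
            c * (ix′ * iy) * t + (c * iy′ * (X * t * ix) + c * t * (X * Y * (ix * iy)))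
              ≈⟨ +-congˡ (+-cong (*-congˡ (sym ht)) (*-congˡ hw)) ⟩
            c * (ix′ * iy) * t + (c * iy′ * (s * t′ * ix) + c * t * (w * (ix * iy)))
              ≈⟨ solve 9 (λ c ix ix′ iy iy′ t t′ s w →
                    c :* (ix′ :* iy) :* t :+ (c :* iy′ :* (s :* t′ :* ix) :+ c :* t :* (w :* (ix :* iy)))
                    := (c :* (ix′ :* iy) :* t :+ s :* (c :* (ix :* iy′) :* t′)) :+ w :* (c :* (ix :* iy) :* t))
                    refl c ix ix′ iy iy′ t t′ s w ⟩
            (c * (ix′ * iy) * t + s * (c * (ix * iy′) * t′)) + w * (c * (ix * iy) * t) ∎)

      -- The bound on L consists of the support bound N + M + 2 for `suc N` and M, and of one more
      -- for the shift.
      ∑-summand-suc : ∀ a b → a ℕ.+ b ≡ m → ∀ N M L → suc (suc (suc (N ℕ.+ M))) ℕ.≤ L →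
        ∑ L (summand σ a b (suc N) M) ≈ (1# + σ * q ^ (a ℕ.+ N ℕ.* m)) * ∑ L (summand σ a b N M)
      ∑-summand-suc a b a+b≡m N M L N+M+3≤L = begin
        ∑ L (summand σ a b (suc N) M)
          ≈⟨ ∑-shift (+ 1) L (summand-supported σ a b (suc N) M) N+M+3≤L ⟨
        ∑ L (λ k → summand σ a b (suc N) M (k ℤ.+ (+ 1)))
          ≈⟨ ∑-cong′ L (summand-suc a b a+b≡m N M) ⟩
        ∑ L (λ k → summand σ a b N M (k ℤ.+ (+ 1)) + s * summand σ a b N M k)
          ≈⟨ ∑-+ L _ _ ⟩
        ∑ L (λ k → summand σ a b N M (k ℤ.+ (+ 1))) + ∑ L (λ k → s * summand σ a b N M k)
          ≈⟨ +-cong (trans (∑-shift (+ 1) L (summand-supported σ a b N M) (ℕ.<⇒≤ N+M+3≤L)) (sym (*-identityˡ _)))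
                    (sym (∑-*ˡ L s _)) ⟩
        1# * ∑ L (summand σ a b N M) + s * ∑ L (summand σ a b N M)
          ≈⟨ distribʳ _ _ _ ⟨
        (1# + s) * ∑ L (summand σ a b N M) ∎
        where
        s : Carrier
        s = σ * q ^ (a ℕ.+ N ℕ.* m)

      ∑-summand-poch : ∀ a b → a ℕ.+ b ≡ m → ∀ N M L → suc (suc (N ℕ.+ M)) ℕ.≤ L →
        ∑ L (summand σ a b N M) ≈ poch σ a m N * ∑ L (summand σ a b 0 M)
      ∑-summand-poch a b a+b≡m zero    M L _ = sym (*-identityˡ _)
      ∑-summand-poch a b a+b≡m (suc N) M L h = begin
        ∑ L (summand σ a b (suc N) M)
          ≈⟨ ∑-summand-suc a b a+b≡m N M L h ⟩
        x * ∑ L (summand σ a b N M)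
          ≈⟨ *-congˡ (∑-summand-poch a b a+b≡m N M L (ℕ.<⇒≤ h)) ⟩
        x * (poch σ a m N * ∑ L (summand σ a b 0 M))
          ≈⟨ trans (sym (*-assoc _ _ _)) (*-congʳ (trans (*-comm _ _) (sym (∏-last N _)))) ⟩
        poch σ a m (suc N) * ∑ L (summand σ a b 0 M) ∎
        where
        x : Carrier
        x = 1# + σ * q ^ (a ℕ.+ N ℕ.* m)

      summand-neg : ∀ a b N M k → summand σ a b N M (ℤ.- k) ≈ summand σ b a M N k
      summand-neg a b N M k = *-cong
        (*-cong (reflexive (cong qfac (ℕ.+-comm N M)))
                (trans (*-congʳ (reflexive (cong (λ z → recipQfac (+ N ℤ.+ z)) (ℤ.neg-involutive k)))) (*-comm _ _)))
        (term-neg σ a b k)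

      -- The recurrence in N strips off the first product. The reflection k ↦ - k exchanges (a, N)
      -- with (b, M), so the same recurrence strips off the second, and only the term k = 0 is left.
      finite-triple-product : ∀ a b → a ℕ.+ b ≡ m → ∀ N M L → suc (suc (N ℕ.+ M)) ℕ.≤ L →
        ∑ L (summand σ a b N M) ≈ poch σ a m N * poch σ b m M
      finite-triple-product a b a+b≡m N M L h = begin
        ∑ L (summand σ a b N M)
          ≈⟨ ∑-summand-poch a b a+b≡m N M L h ⟩
        poch σ a m N * ∑ L (summand σ a b 0 M)
          ≈⟨ *-congˡ (∑-neg L (λ k L≤k → summand-supported σ a b 0 M k (ℕ.≤-trans M+1≤L L≤k))) ⟨
        poch σ a m N * ∑ L (λ k → summand σ a b 0 M (ℤ.- k))
          ≈⟨ *-congˡ (∑-cong′ L (summand-neg a b 0 M)) ⟩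
        poch σ a m N * ∑ L (summand σ b a M 0)
          ≈⟨ *-congˡ (∑-summand-poch b a (≡.trans (ℕ.+-comm b a) a+b≡m) M 0 L M+2≤L) ⟩
        poch σ a m N * (poch σ b m M * ∑ L (summand σ b a 0 0))
          ≈⟨ *-congˡ (trans (*-congˡ (initial L (ℕ.≤-trans (ℕ.s≤s ℕ.z≤n) M+1≤L))) (*-identityʳ _)) ⟩
        poch σ a m N * poch σ b m M ∎
        where
        M+2≤L : suc (suc (M ℕ.+ 0)) ℕ.≤ L
        M+2≤L = ℕ.≤-trans (ℕ.≤-reflexive (cong (λ n → suc (suc n)) (ℕ.+-identityʳ M)))
                          (ℕ.≤-trans (ℕ.s≤s (ℕ.s≤s (ℕ.m≤n+m M N))) h)
        M+1≤L : suc M ℕ.≤ L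
        M+1≤L = ℕ.≤-trans (ℕ.s≤s (ℕ.m≤n+m M N)) (ℕ.<⇒≤ h)
        initial : ∀ L → 1 ℕ.≤ L → ∑ L (summand σ b a 0 0) ≈ 1#
        initial (suc L) _ = begin
          ∑ (suc L) (summand σ b a 0 0)        ≈⟨ ∑-single L (summand-supported σ b a 0 0) ⟩
          (1# * (1# * 1#)) * (1# * q ^ exponent b a (+ 0))
            ≈⟨ *-cong (trans (*-identityˡ _) (*-identityˡ _)) (*-identityˡ _) ⟩
          1# * q ^ exponent b a (+ 0)          ≈⟨ *-identityˡ _ ⟩
          q ^ exponent b a (+ 0)
            ≡⟨ cong (q ^_) (cong₂ ℕ._+_ (ℕ.*-zeroʳ b) (ℕ.*-zeroʳ (b ℕ.+ a))) ⟩
          1# ∎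

  -- At N = M = 2K every coefficient with |k| ≤ K equals 1/(q^m;q^m)_K, and for larger |k| the theta
  -- term is zero. Multiplying by (q^m;q^m)_K leaves the theta series.
  triple-product : ∀ {σ} → IsSign σ → ∀ a b → 1 ℕ.≤ a → 1 ℕ.≤ b →
    θ σ a b ≈ (poch σ a (a ℕ.+ b) K * poch σ b (a ℕ.+ b) K) * poch (- 1#) (a ℕ.+ b) (a ℕ.+ b) K
  triple-product {σ} σσ≈1 a b 1≤a 1≤b = sym (begin
    (poch σ a m K * poch σ b m K) * qfac m 1≤m K
      ≈⟨ *-congʳ (*-cong (poch-stable σ a m 1≤a 1≤m K) (poch-stable σ b m 1≤b 1≤m K)) ⟨
    (poch σ a m H * poch σ b m H) * qfac m 1≤m K
      ≈⟨ *-congʳ (finite-triple-product m 1≤m σσ≈1 a b ≡.refl H H L (ℕ.m≤n+m _ K)) ⟨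
    ∑ L (summand m 1≤m σ a b H H) * qfac m 1≤m K
      ≈⟨ ∑-*ʳ L _ _ ⟩
    ∑ L (λ k → summand m 1≤m σ a b H H k * qfac m 1≤m K)
      ≈⟨ ∑-cong′ L normalise ⟩
    ∑ L (term σ a b)
      ≈⟨ θ-∑ σ 1≤a 1≤b _ ⟩
    θ σ a b ∎)
    where
    m H L : ℕ
    m = a ℕ.+ b
    H = K ℕ.+ K
    L = K ℕ.+ suc (suc (H ℕ.+ H))
    1≤m : 1 ℕ.≤ m
    1≤m = ℕ.m≤n⇒m≤n+o b 1≤a

    recip-large : ∀ j → ∣ j ∣ ℕ.≤ K → recipQfac m 1≤m (+ H ℤ.+ j) ≈ recipQfac m 1≤m (+ K)
    recip-large j j≤K = let d , e = +[K+K]+j-large K j j≤K in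
      trans (reflexive (cong (recipQfac m 1≤m) e)) (recipQfac-stable m 1≤m d)

    qfac-HH : qfac m 1≤m (H ℕ.+ H) ≈ qfac m 1≤m K
    qfac-HH = trans (reflexive (cong (qfac m 1≤m) (ℕ.+-assoc K K H))) (poch-stable (- 1#) m m 1≤m 1≤m (K ℕ.+ H))

    normalise : ∀ k → summand m 1≤m σ a b H H k * qfac m 1≤m K ≈ term σ a b k
    normalise k with ∣ k ∣ ℕ.≤? K
    ... | no k≰K = trans (*-congʳ (trans (*-congˡ t≈0) (zeroʳ _))) (trans (zeroˡ _) (sym t≈0))
      where
      t≈0 : term σ a b k ≈ 0#
      t≈0 = term-supported σ 1≤a 1≤b k (ℕ.<⇒≤ (ℕ.≰⇒> k≰K))
    ... | yes k≤K = begin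
      summand m 1≤m σ a b H H k * qfac m 1≤m K
        ≈⟨ *-congʳ (*-congʳ (*-cong qfac-HH (*-cong
             (recip-large (ℤ.- k) (ℕ.≤-trans (ℕ.≤-reflexive (ℤ.∣-i∣≡∣i∣ k)) k≤K)) (recip-large k k≤K)))) ⟩
      ((x * (y * y)) * term σ a b k) * x
        ≈⟨ solve 3 (λ x y t → ((x :* (y :* y)) :* t) :* x := ((x :* y) :* (x :* y)) :* t) refl x y (term σ a b k) ⟩
      ((x * y) * (x * y)) * term σ a b k
        ≈⟨ *-congʳ (trans (*-cong (qfac-inverse m 1≤m K) (qfac-inverse m 1≤m K)) (*-identityˡ 1#)) ⟩
      1# * term σ a b k
        ≈⟨ *-identityˡ _ ⟩
      term σ a b k ∎
      where
      x y : Carrier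
      x = qfac m 1≤m K
      y = recipQfac m 1≤m (+ K)

-- Theta quotients as products over residues modulo 80.

open SortingAlgorithm insertionSort using (sort; sort-↭)

-- Reduces the rearrangements of explicit residue lists to computation.
sort-≡⇒↭ : ∀ {xs ys} → sort xs ≡ sort ys → xs ↭ ys
sort-≡⇒↭ {xs} {ys} e = ↭-trans (↭-sym (sort-↭ xs)) (↭-trans (↭-reflexive e) (sort-↭ ys))

S₁ T₁ S₂ T₂ : List ℕ
S₁ = 4 ∷ 5 ∷ 6 ∷ 7 ∷ 15 ∷ 17 ∷ 23 ∷ 25 ∷ 26 ∷ 33 ∷ 35 ∷ 36 ∷ []
T₁ = 2 ∷ 5 ∷ 11 ∷ 12 ∷ 15 ∷ 18 ∷ 19 ∷ 21 ∷ 25 ∷ 28 ∷ 29 ∷ 35 ∷ []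
S₂ = 3 ∷ 4 ∷ 5 ∷ 13 ∷ 14 ∷ 15 ∷ 25 ∷ 27 ∷ 34 ∷ 35 ∷ 36 ∷ 37 ∷ []
T₂ = 1 ∷ 5 ∷ 9 ∷ 12 ∷ 15 ∷ 22 ∷ 25 ∷ 28 ∷ 31 ∷ 35 ∷ 38 ∷ 39 ∷ []

± : List ℕ → List ℕ
± []       = []
± (r ∷ rs) = r ∷ 80 ℕ.∸ r ∷ ± rs

module ThetaIdentities {c ℓ} (R : CommutativeRing c ℓ) (q : CommutativeRing.Carrier R)
  (K : ℕ) (q^n≈0 : NilpotentFrom R K q) where

  open CommutativeRing R
  open Theta R q K q^n≈0
  open TripleProduct R q K q^n≈0
  open Exp semiring
  open import Relation.Binary.Reasoning.Setoid setoid
  open import Algebra.Properties.CommutativeSemigroup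
    (CommutativeMonoid.commutativeSemigroup *-commutativeMonoid) using (interchange; x∙yz≈y∙xz)
  open SemiringSolver commutativeSemiring using (solve; _:=_; _:+_; _:*_; _:^_; con)
  open CommutativeMonoidSolver *-commutativeMonoid using (_⊕_; _⊜_) renaming (solve to solve-*)

  poch-split : ∀ σ r m → 1 ℕ.≤ r → 1 ℕ.≤ m →
               poch σ r m K ≈ poch σ r (m ℕ.+ m) K * poch σ (m ℕ.+ r) (m ℕ.+ m) K
  poch-split σ r m 1≤r 1≤m = begin
    poch σ r m K
      ≈⟨ poch-stable σ r m 1≤r 1≤m K ⟨
    poch σ r m (K ℕ.+ K)
      ≡⟨ cong (poch σ r m) (double K) ⟩
    poch σ r m (K ℕ.* 2)
      ≈⟨ ∏-block K 2 _ ⟩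
    ∏ K (λ i → (1# + σ * q ^ (r ℕ.+ (0 ℕ.+ i ℕ.* 2) ℕ.* m)) * ((1# + σ * q ^ (r ℕ.+ (1 ℕ.+ i ℕ.* 2) ℕ.* m)) * 1#))
      ≈⟨ ∏-cong′ K (λ i → *-cong (at (even r m i)) (trans (*-identityʳ _) (at (odd r m i)))) ⟩
    ∏ K (λ i → (1# + σ * q ^ (r ℕ.+ i ℕ.* (m ℕ.+ m))) * (1# + σ * q ^ ((m ℕ.+ r) ℕ.+ i ℕ.* (m ℕ.+ m))))
      ≈⟨ ∏-* K _ _ ⟩
    poch σ r (m ℕ.+ m) K * poch σ (m ℕ.+ r) (m ℕ.+ m) K ∎
    where
    at : ∀ {x y} → x ≡ y → 1# + σ * q ^ x ≈ 1# + σ * q ^ y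
    at e = +-congˡ (*-congˡ (^-congʳ q e))
    double : ∀ n → n ℕ.+ n ≡ n ℕ.* 2
    double = solve-∀ℕ
    even : ∀ r m i → r ℕ.+ (i ℕ.* 2) ℕ.* m ≡ r ℕ.+ i ℕ.* (m ℕ.+ m)
    even = solve-∀ℕ
    odd : ∀ r m i → r ℕ.+ (1 ℕ.+ i ℕ.* 2) ℕ.* m ≡ (m ℕ.+ r) ℕ.+ i ℕ.* (m ℕ.+ m)
    odd = solve-∀ℕ

  -- Factorwise (1 - x)(1 + x) = 1 - x². This absorbs the unsigned products of the thetas into
  -- signed ones.
  poch-double : ∀ r m n → poch (- 1#) r m n * poch 1# r m n ≈ poch (- 1#) (r ℕ.+ r) (m ℕ.+ m) n
  poch-double r m n = trans (sym (∏-* n _ _)) (∏-cong′ n (λ i → trans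
    (difference-of-squares (q ^ (r ℕ.+ i ℕ.* m)))
    (+-congˡ (*-congˡ (trans (sym (^-homo-* q (r ℕ.+ i ℕ.* m) _)) (^-congʳ q (double r m i)))))))
    where
    double : ∀ r m i → (r ℕ.+ i ℕ.* m) ℕ.+ (r ℕ.+ i ℕ.* m) ≡ (r ℕ.+ r) ℕ.+ i ℕ.* (m ℕ.+ m)
    double = solve-∀ℕ
    difference-of-squares : ∀ x → (1# + - 1# * x) * (1# + 1# * x) ≈ 1# + - 1# * (x * x)
    difference-of-squares x = trans
      (solve 2 (λ n x → (con 1 :+ n :* x) :* (con 1 :+ con 1 :* x) := ((con 1 :+ n :* x) :+ x) :+ n :* (x :* x))
               refl (- 1#) x)
      (+-congʳ (1-x+x x))

  poch-inverse : ∀ r m n → 1 ℕ.≤ r → ∃ λ x → poch (- 1#) r m n * x ≈ 1#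
  poch-inverse r m n 1≤r = ∏ n (λ i → recip (r ℕ.+ i ℕ.* m)) , (begin
    poch (- 1#) r m n * ∏ n (λ i → recip (r ℕ.+ i ℕ.* m))
      ≈⟨ ∏-* n _ _ ⟨
    ∏ n (λ i → (1# + - 1# * q ^ (r ℕ.+ i ℕ.* m)) * recip (r ℕ.+ i ℕ.* m))
      ≈⟨ ∏-cong′ n (λ i → recip-inverse _ (ℕ.m≤n⇒m≤n+o _ 1≤r)) ⟩
    ∏ n (λ _ → 1#)
      ≈⟨ ∏-1 n ⟩
    1# ∎)

  poch₈₀ : ℕ → Carrier
  poch₈₀ r = poch (- 1#) r 80 K

  -- Products are recorded by their residues modulo 80, so that regrouping them is a permutation of
  -- lists.
  ∏ₗ : List ℕ → Carrier
  ∏ₗ = foldr (λ r x → poch₈₀ r * x) 1#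

  ∏ₗ-↭ : ∀ {rs ss} → rs ↭ ss → ∏ₗ rs ≈ ∏ₗ ss
  ∏ₗ-↭ Perm.refl           = refl
  ∏ₗ-↭ (Perm.prep r p)     = *-congˡ (∏ₗ-↭ p)
  ∏ₗ-↭ (Perm.swap r s p)   = trans (*-congˡ (*-congˡ (∏ₗ-↭ p))) (x∙yz≈y∙xz _ _ _)
  ∏ₗ-↭ (Perm.trans p p′)   = trans (∏ₗ-↭ p) (∏ₗ-↭ p′)

  ∏ₗ-++ : ∀ rs ss → ∏ₗ (rs ++ ss) ≈ ∏ₗ rs * ∏ₗ ss
  ∏ₗ-++ []       ss = sym (*-identityˡ _)
  ∏ₗ-++ (r ∷ rs) ss = trans (*-congˡ (∏ₗ-++ rs ss)) (sym (*-assoc _ _ _))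

  mod20 mod40 : ℕ → List ℕ
  mod40 r = r ∷ 40 ℕ.+ r ∷ []
  mod20 r = mod40 r ++ mod40 (20 ℕ.+ r)

  ∏ₗ-mod40 : ∀ r → 1 ℕ.≤ r → ∏ₗ (mod40 r) ≈ poch (- 1#) r 40 K
  ∏ₗ-mod40 r 1≤r = trans (*-congˡ (*-identityʳ _)) (sym (poch-split (- 1#) r 40 1≤r (ℕ.s≤s ℕ.z≤n)))

  ∏ₗ-mod20 : ∀ r → 1 ℕ.≤ r → ∏ₗ (mod20 r) ≈ poch (- 1#) r 20 K
  ∏ₗ-mod20 r 1≤r = begin
    ∏ₗ (mod20 r)
      ≈⟨ ∏ₗ-++ (mod40 r) (mod40 (20 ℕ.+ r)) ⟩
    ∏ₗ (mod40 r) * ∏ₗ (mod40 (20 ℕ.+ r))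
      ≈⟨ *-cong (∏ₗ-mod40 r 1≤r) (∏ₗ-mod40 (20 ℕ.+ r) (ℕ.s≤s ℕ.z≤n)) ⟩
    poch (- 1#) r 40 K * poch (- 1#) (20 ℕ.+ r) 40 K
      ≈⟨ poch-split (- 1#) r 20 1≤r (ℕ.s≤s ℕ.z≤n) ⟨
    poch (- 1#) r 20 K ∎

  ∏ₗ-double : ∀ r → 1 ℕ.≤ r → ∏ₗ (mod40 r) * poch 1# r 40 K ≈ poch₈₀ (r ℕ.+ r)
  ∏ₗ-double r 1≤r = trans (*-congʳ (∏ₗ-mod40 r 1≤r)) (poch-double r 40 K)

  triple : Carrier → ℕ → ℕ → ℕ → Carrier
  triple σ a b m = (poch σ a m K * poch σ b m K) * poch (- 1#) m m K

  Δ : Carrier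
  Δ = θ (- 1#) 5 15 * (θ (- 1#) 4 36 * θ (- 1#) 12 28)

  -- Doubling pairs the factors of `rs` at c₁, ..., c₄ modulo 40 with the unsigned ones of the two
  -- modulus-40 thetas and gives the residues 2cᵢ modulo 80. Together with `es` these fill the
  -- classes h and h′ modulo 20; doubling again against the modulus-20 theta gives 2h and 2h′ modulo
  -- 40. The classes 5 and 15 modulo 20 and g, g′ modulo 40 are left as they are. Thus `es` lists
  -- the even residues of `rs` outside g and g′ modulo 40.
  θ-eta : ∀ c₁ c₂ c₃ c₄ es h h′ g g′ rs →
    .{{ℕ.NonZero c₁}} → .{{ℕ.NonZero c₂}} → .{{ℕ.NonZero c₃}} → .{{ℕ.NonZero c₄}} →
    .{{ℕ.NonZero h}} → .{{ℕ.NonZero h′}} → .{{ℕ.NonZero g}} → .{{ℕ.NonZero g′}} →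
    (c₁ ℕ.+ c₁ ∷ c₂ ℕ.+ c₂ ∷ c₃ ℕ.+ c₃ ∷ c₄ ℕ.+ c₄ ∷ es) ↭ (mod20 h ++ mod20 h′) →
    rs ↭ ((mod40 c₁ ++ mod40 c₂ ++ mod40 c₃ ++ mod40 c₄) ++ es ++ (mod20 5 ++ mod20 15) ++ mod40 g ++ mod40 g′) →
    ((triple 1# c₁ c₂ 40 * triple 1# c₃ c₄ 40) * triple 1# h h′ 20) * ∏ₗ rs ≈
      triple (- 1#) 5 15 20 * (triple (- 1#) (h ℕ.+ h) (h′ ℕ.+ h′) 40 * triple (- 1#) g g′ 40)
  θ-eta c₁ c₂ c₃ c₄ es h h′ g g′ rs classes parts = begin
    (((p₊ c₁ * p₊ c₂ * E) * (p₊ c₃ * p₊ c₄ * E)) * (P₊ h * P₊ h′ * E′)) * ∏ₗ rs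
      ≈⟨ *-congˡ expand ⟩
    (((p₊ c₁ * p₊ c₂ * E) * (p₊ c₃ * p₊ c₄ * E)) * (P₊ h * P₊ h′ * E′)) *
      ((l c₁ * (l c₂ * (l c₃ * l c₄))) * (∏ₗ es * ((A * A′) * (G * G′))))
      ≈⟨ solve-* 17 (λ p₁ p₂ p₃ p₄ l₁ l₂ l₃ l₄ e P P′ A A′ G G′ E E′ →
            ((((p₁ ⊕ p₂) ⊕ E) ⊕ ((p₃ ⊕ p₄) ⊕ E)) ⊕ ((P ⊕ P′) ⊕ E′)) ⊕
              ((l₁ ⊕ (l₂ ⊕ (l₃ ⊕ l₄))) ⊕ (e ⊕ ((A ⊕ A′) ⊕ (G ⊕ G′))))
            ⊜ ((((l₁ ⊕ p₁) ⊕ ((l₂ ⊕ p₂) ⊕ ((l₃ ⊕ p₃) ⊕ ((l₄ ⊕ p₄) ⊕ e)))) ⊕ (P ⊕ P′)) ⊕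
                (((A ⊕ A′) ⊕ E′) ⊕ (E ⊕ ((G ⊕ G′) ⊕ E))))) refl
            (p₊ c₁) (p₊ c₂) (p₊ c₃) (p₊ c₄) (l c₁) (l c₂) (l c₃) (l c₄) (∏ₗ es) (P₊ h) (P₊ h′) A A′ G G′ E E′ ⟩
    (((l c₁ * p₊ c₁) * ((l c₂ * p₊ c₂) * ((l c₃ * p₊ c₃) * ((l c₄ * p₊ c₄) * ∏ₗ es)))) * (P₊ h * P₊ h′)) *
      (((A * A′) * E′) * (E * ((G * G′) * E)))
      ≈⟨ *-congʳ (*-congʳ (*-cong (∏ₗ-double c₁ nz) (*-cong (∏ₗ-double c₂ nz)
            (*-cong (∏ₗ-double c₃ nz) (*-congʳ (∏ₗ-double c₄ nz)))))) ⟩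
    (∏ₗ (c₁ ℕ.+ c₁ ∷ c₂ ℕ.+ c₂ ∷ c₃ ℕ.+ c₃ ∷ c₄ ℕ.+ c₄ ∷ es) * (P₊ h * P₊ h′)) *
      (((A * A′) * E′) * (E * ((G * G′) * E)))
      ≈⟨ *-congʳ (*-congʳ (trans (∏ₗ-↭ classes) (trans (∏ₗ-++ (mod20 h) (mod20 h′)) (*-cong (∏ₗ-mod20 h nz) (∏ₗ-mod20 h′ nz))))) ⟩
    ((P₋ h * P₋ h′) * (P₊ h * P₊ h′)) * (((A * A′) * E′) * (E * ((G * G′) * E)))
      ≈⟨ *-congʳ (trans (interchange _ _ _ _) (*-cong (poch-double h 20 K) (poch-double h′ 20 K))) ⟩
    (H * H′) * (((A * A′) * E′) * (E * ((G * G′) * E)))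
      ≈⟨ solve-* 8 (λ H H′ A A′ G G′ E E′ →
            (H ⊕ H′) ⊕ (((A ⊕ A′) ⊕ E′) ⊕ (E ⊕ ((G ⊕ G′) ⊕ E)))
            ⊜ ((A ⊕ A′) ⊕ E′) ⊕ (((H ⊕ H′) ⊕ E) ⊕ ((G ⊕ G′) ⊕ E))) refl H H′ A A′ G G′ E E′ ⟩
    ((A * A′) * E′) * (((H * H′) * E) * ((G * G′) * E)) ∎
    where
    nz : ∀ {r} .{{_ : ℕ.NonZero r}} → 1 ℕ.≤ r
    nz {r} = ℕ.>-nonZero⁻¹ r
    p₊ P₊ P₋ l : ℕ → Carrier
    p₊ r = poch 1# r 40 K
    P₊ r = poch 1# r 20 K
    P₋ r = poch (- 1#) r 20 K
    l r = ∏ₗ (mod40 r)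
    A A′ G G′ E E′ H H′ : Carrier
    A  = poch (- 1#) 5 20 K
    A′ = poch (- 1#) 15 20 K
    G  = poch (- 1#) g 40 K
    G′ = poch (- 1#) g′ 40 K
    H  = poch (- 1#) (h ℕ.+ h) 40 K
    H′ = poch (- 1#) (h′ ℕ.+ h′) 40 K
    E  = poch (- 1#) 40 40 K
    E′ = poch (- 1#) 20 20 K
    expand : ∏ₗ rs ≈ (l c₁ * (l c₂ * (l c₃ * l c₄))) * (∏ₗ es * ((A * A′) * (G * G′)))
    expand = trans (∏ₗ-↭ parts)
      (concat (mod40 c₁ ++ mod40 c₂ ++ mod40 c₃ ++ mod40 c₄) (es ++ (mod20 5 ++ mod20 15) ++ mod40 g ++ mod40 g′)
        (concat (mod40 c₁) (mod40 c₂ ++ mod40 c₃ ++ mod40 c₄) refl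
          (concat (mod40 c₂) (mod40 c₃ ++ mod40 c₄) refl (∏ₗ-++ (mod40 c₃) (mod40 c₄))))
        (concat es ((mod20 5 ++ mod20 15) ++ mod40 g ++ mod40 g′) refl
          (concat (mod20 5 ++ mod20 15) (mod40 g ++ mod40 g′)
            (concat (mod20 5) (mod20 15) (∏ₗ-mod20 5 nz) (∏ₗ-mod20 15 nz))
            (concat (mod40 g) (mod40 g′) (∏ₗ-mod40 g nz) (∏ₗ-mod40 g′ nz)))))
      where
      concat : ∀ rs ss {x y} → ∏ₗ rs ≈ x → ∏ₗ ss ≈ y → ∏ₗ (rs ++ ss) ≈ x * y
      concat rs ss e e′ = trans (∏ₗ-++ rs ss) (*-cong e e′)

  private
    1≤ : ∀ {r} .{{_ : ℕ.NonZero r}} → 1 ℕ.≤ r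
    1≤ {r} = ℕ.>-nonZero⁻¹ r

    triple⁺ : ∀ a b .{{_ : ℕ.NonZero a}} .{{_ : ℕ.NonZero b}} → θ 1# a b ≈ triple 1# a b (a ℕ.+ b)
    triple⁺ a b = triple-product 1-isSign a b 1≤ 1≤

    triple⁻ : ∀ a b .{{_ : ℕ.NonZero a}} .{{_ : ℕ.NonZero b}} → θ (- 1#) a b ≈ triple (- 1#) a b (a ℕ.+ b)
    triple⁻ a b = triple-product -1-isSign a b 1≤ 1≤

  x y z w f₂ f₆ : Carrier
  x  = θ 1# 1 39 * θ 1# 9 31
  y  = θ 1# 3 37 * θ 1# 13 27
  z  = θ 1# 11 29 * θ 1# 19 21
  w  = θ 1# 7 33 * θ 1# 17 23
  f₂ = θ 1# 2 18
  f₆ = θ 1# 6 14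

  z-T₁ : (z * f₂) * ∏ₗ (± T₁) ≈ Δ
  z-T₁ = trans (*-congʳ (*-cong (*-cong (triple⁺ 11 29) (triple⁺ 19 21)) (triple⁺ 2 18)))
    (trans (θ-eta 11 29 19 21 (2 ∷ 62 ∷ 18 ∷ 78 ∷ []) 2 18 12 28 (± T₁) (sort-≡⇒↭ ≡.refl) (sort-≡⇒↭ ≡.refl))
           (sym (*-cong (triple⁻ 5 15) (*-cong (triple⁻ 4 36) (triple⁻ 12 28)))))

  x-T₂ : (x * f₂) * ∏ₗ (± T₂) ≈ Δ
  x-T₂ = trans (*-congʳ (*-cong (*-cong (triple⁺ 1 39) (triple⁺ 9 31)) (triple⁺ 2 18)))
    (trans (θ-eta 1 39 9 31 (22 ∷ 42 ∷ 38 ∷ 58 ∷ []) 2 18 12 28 (± T₂) (sort-≡⇒↭ ≡.refl) (sort-≡⇒↭ ≡.refl))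
           (sym (*-cong (triple⁻ 5 15) (*-cong (triple⁻ 4 36) (triple⁻ 12 28)))))

  w-S₁ : (w * f₆) * ∏ₗ (± S₁) ≈ Δ
  w-S₁ = trans (*-congʳ (*-cong (*-cong (triple⁺ 7 33) (triple⁺ 17 23)) (triple⁺ 6 14)))
    (trans (θ-eta 7 33 17 23 (6 ∷ 26 ∷ 54 ∷ 74 ∷ []) 6 14 4 36 (± S₁) (sort-≡⇒↭ ≡.refl) (sort-≡⇒↭ ≡.refl))
           -- Here 2h = 12 and g = 4, so the two modulus-40 factors of Δ arrive in the opposite
           -- order.
           (sym (*-cong (triple⁻ 5 15) (trans (*-comm _ _) (*-cong (triple⁻ 12 28) (triple⁻ 4 36))))))

  y-S₂ : (y * f₆) * ∏ₗ (± S₂) ≈ Δ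
  y-S₂ = trans (*-congʳ (*-cong (*-cong (triple⁺ 3 37) (triple⁺ 13 27)) (triple⁺ 6 14)))
    (trans (θ-eta 3 37 13 27 (14 ∷ 34 ∷ 46 ∷ 66 ∷ []) 6 14 4 36 (± S₂) (sort-≡⇒↭ ≡.refl) (sort-≡⇒↭ ≡.refl))
           (sym (*-cong (triple⁻ 5 15) (trans (*-comm _ _) (*-cong (triple⁻ 12 28) (triple⁻ 4 36))))))

  Δ-inverse : ∃ λ v → Δ * v ≈ 1#
  Δ-inverse = _ , trans (*-congʳ (*-cong (triple⁻ 5 15) (*-cong (triple⁻ 4 36) (triple⁻ 12 28))))
    (proj₂ (unit-* (unit-triple 5 15 20) (unit-* (unit-triple 4 36 40) (unit-triple 12 28 40))))
    where
    unit-* : ∀ {a b} → (∃ λ v → a * v ≈ 1#) → (∃ λ v → b * v ≈ 1#) → ∃ λ v → (a * b) * v ≈ 1#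
    unit-* (v , av≈1) (v′ , bv′≈1) = v * v′ , trans (interchange _ _ _ _) (trans (*-cong av≈1 bv′≈1) (*-identityˡ 1#))
    unit-triple : ∀ a b m .{{_ : ℕ.NonZero a}} .{{_ : ℕ.NonZero b}} .{{_ : ℕ.NonZero m}} →
                  ∃ λ v → triple (- 1#) a b m * v ≈ 1#
    unit-triple a b m = unit-* (unit-* (poch-inverse a m K 1≤) (poch-inverse b m K 1≤)) (poch-inverse m m K 1≤)

  -- The two theta identities.

  θ₈₀ : ℕ → Carrier
  θ₈₀ r = θ 1# r (80 ℕ.∸ r)

  private
    product⁺ : ∀ t r s .{{_ : ℕ.NonZero t}} .{{_ : ℕ.NonZero r}} .{{_ : ℕ.NonZero s}} →
      θ 1# t (t ℕ.+ r ℕ.+ s) * θ 1# (t ℕ.+ s) (t ℕ.+ r) ≈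
        θ 1# (t ℕ.+ t ℕ.+ s) (t ℕ.+ t ℕ.+ r ℕ.+ r ℕ.+ s) * θ 1# (t ℕ.+ t ℕ.+ r) (t ℕ.+ t ℕ.+ r ℕ.+ s ℕ.+ s)
        + q ^ t * (θ 1# r (4 ℕ.* t ℕ.+ s ℕ.+ s ℕ.+ r) * θ 1# s (4 ℕ.* t ℕ.+ r ℕ.+ r ℕ.+ s))
    product⁺ t r s = trans (θ-product 1-isSign t r s 1≤ 1≤ 1≤) (+-congˡ (*-congʳ (*-identityˡ _)))

    dissection⁺ : ∀ a r .{{_ : ℕ.NonZero a}} .{{_ : ℕ.NonZero r}} →
      θ 1# a (a ℕ.+ r) ≈ θ 1# (4 ℕ.* a ℕ.+ r) (4 ℕ.* a ℕ.+ 3 ℕ.* r) + q ^ a * θ 1# r (8 ℕ.* a ℕ.+ 3 ℕ.* r)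
    dissection⁺ a r = trans (θ-dissection 1-isSign a r 1≤ 1≤) (+-congˡ (*-congʳ (*-identityˡ _)))

    transpose : ∀ {a b u v} → a ≈ b + (- 1# * u) * v → a + u * v ≈ b
    transpose {a} {b} {u} {v} e = begin
      a + u * v                        ≈⟨ +-congʳ e ⟩
      (b + (- 1# * u) * v) + u * v     ≈⟨ trans (+-assoc _ _ _) (+-congˡ (sym (distribʳ _ _ _))) ⟩
      b + (- 1# * u + u) * v           ≈⟨ +-congˡ (*-congʳ (trans (+-congʳ (RingProperties.-1*x≈-x ring u)) (-‿inverseˡ u))) ⟩
      b + 0# * v                       ≈⟨ trans (+-congˡ (zeroˡ v)) (+-identityʳ b) ⟩
      b                                ∎

  -- In these four expansions t is the smallest parameter, and s and r are the distances from t to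
  -- the parameters of the other factor: 9 = 1 + 8 and 31 = 1 + 30.
  x-expand : x ≈ θ₈₀ 10 * θ₈₀ 32 + q ^ 1 * (θ₈₀ 30 * θ₈₀ 8)
  x-expand = product⁺ 1 30 8

  y-expand : y ≈ θ₈₀ 16 * θ₈₀ 30 + q ^ 3 * (θ₈₀ 24 * θ₈₀ 10)
  y-expand = product⁺ 3 24 10

  w-expand : w ≈ θ₈₀ 24 * θ₈₀ 30 + q ^ 7 * (θ₈₀ 16 * θ₈₀ 10)
  w-expand = product⁺ 7 16 10

  z-expand : z ≈ θ₈₀ 30 * θ₈₀ 32 + q ^ 11 * (θ₈₀ 10 * θ₈₀ 8)
  z-expand = product⁺ 11 10 8

  f₂-expand : f₂ ≈ θ₈₀ 24 + q ^ 2 * θ₈₀ 16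
  f₂-expand = dissection⁺ 2 16

  f₆-expand : f₆ ≈ θ₈₀ 32 + q ^ 6 * θ₈₀ 8
  f₆-expand = dissection⁺ 6 8

  θ⁻5,15-expand : θ (- 1#) 5 15 + q ^ 5 * θ₈₀ 10 ≈ θ₈₀ 30
  θ⁻5,15-expand = transpose (θ-dissection -1-isSign 5 10 1≤ 1≤)

  θ⁻4,36*θ⁻12,28-expand : θ (- 1#) 4 36 * θ (- 1#) 12 28 + q ^ 4 * (θ₈₀ 24 * θ₈₀ 8) ≈ θ₈₀ 16 * θ₈₀ 32
  θ⁻4,36*θ⁻12,28-expand = transpose (θ-product -1-isSign 4 24 8 1≤ 1≤ 1≤)

  zf₂≈wf₆+q²Δ : z * f₂ ≈ w * f₆ + q ^ 2 * Δ
  zf₂≈wf₆+q²Δ = trans (*-cong z-expand f₂-expand) (trans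
    (algebra q (θ₈₀ 8) (θ₈₀ 10) (θ₈₀ 16) (θ₈₀ 24) (θ₈₀ 30) (θ₈₀ 32) _ _ θ⁻5,15-expand θ⁻4,36*θ⁻12,28-expand)
    (sym (+-congʳ (*-cong w-expand f₆-expand))))
    where
    -- Replacing T₃₀ (T₁₆ T₃₂) by the product of the two hypotheses creates ψ F and a second copy of
    -- q^11 T₈ T₁₀ T₂₄. One copy completes ψ back to T₃₀, the other completes F back to T₁₆ T₃₂.
    algebra : ∀ q T₈ T₁₀ T₁₆ T₂₄ T₃₀ T₃₂ ψ F → ψ + q ^ 5 * T₁₀ ≈ T₃₀ → F + q ^ 4 * (T₂₄ * T₈) ≈ T₁₆ * T₃₂ →
      (T₃₀ * T₃₂ + q ^ 11 * (T₁₀ * T₈)) * (T₂₄ + q ^ 2 * T₁₆)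
      ≈ (T₂₄ * T₃₀ + q ^ 7 * (T₁₆ * T₁₀)) * (T₃₂ + q ^ 6 * T₈) + q ^ 2 * (ψ * F)
    algebra q T₈ T₁₀ T₁₆ T₂₄ T₃₀ T₃₂ ψ F hψ hF = begin
      (T₃₀ * T₃₂ + q ^ 11 * (T₁₀ * T₈)) * (T₂₄ + q ^ 2 * T₁₆)
        ≈⟨ solve 7 (λ q T₈ T₁₀ T₁₆ T₂₄ T₃₀ T₃₂ →
             (T₃₀ :* T₃₂ :+ q :^ 11 :* (T₁₀ :* T₈)) :* (T₂₄ :+ q :^ 2 :* T₁₆)
             := T₃₀ :* T₃₂ :* T₂₄ :+ q :^ 11 :* (T₁₀ :* T₈) :* (T₂₄ :+ q :^ 2 :* T₁₆) :+ q :^ 2 :* T₃₀ :* (T₁₆ :* T₃₂))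
             refl q T₈ T₁₀ T₁₆ T₂₄ T₃₀ T₃₂ ⟩
      T₃₀ * T₃₂ * T₂₄ + q ^ 11 * (T₁₀ * T₈) * (T₂₄ + q ^ 2 * T₁₆) + q ^ 2 * T₃₀ * (T₁₆ * T₃₂)
        ≈⟨ +-congˡ (*-cong (*-congˡ hψ) hF) ⟨
      T₃₀ * T₃₂ * T₂₄ + q ^ 11 * (T₁₀ * T₈) * (T₂₄ + q ^ 2 * T₁₆) + q ^ 2 * (ψ + q ^ 5 * T₁₀) * (F + q ^ 4 * (T₂₄ * T₈))
        ≈⟨ solve 9 (λ q T₈ T₁₀ T₁₆ T₂₄ T₃₀ T₃₂ ψ F →
             T₃₀ :* T₃₂ :* T₂₄ :+ q :^ 11 :* (T₁₀ :* T₈) :* (T₂₄ :+ q :^ 2 :* T₁₆) :+ q :^ 2 :* (ψ :+ q :^ 5 :* T₁₀) :* (F :+ q :^ 4 :* (T₂₄ :* T₈))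
             := T₃₀ :* T₃₂ :* T₂₄ :+ q :^ 6 :* T₂₄ :* T₈ :* (ψ :+ q :^ 5 :* T₁₀)
                :+ q :^ 7 :* T₁₀ :* (F :+ q :^ 4 :* (T₂₄ :* T₈)) :+ q :^ 13 :* T₁₀ :* T₈ :* T₁₆ :+ q :^ 2 :* (ψ :* F))
             refl q T₈ T₁₀ T₁₆ T₂₄ T₃₀ T₃₂ ψ F ⟩
      T₃₀ * T₃₂ * T₂₄ + q ^ 6 * T₂₄ * T₈ * (ψ + q ^ 5 * T₁₀)
        + q ^ 7 * T₁₀ * (F + q ^ 4 * (T₂₄ * T₈)) + q ^ 13 * T₁₀ * T₈ * T₁₆ + q ^ 2 * (ψ * F)
        ≈⟨ +-congʳ (+-congʳ (+-cong (+-congˡ (*-congˡ hψ)) (*-congˡ hF))) ⟩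
      T₃₀ * T₃₂ * T₂₄ + q ^ 6 * T₂₄ * T₈ * T₃₀
        + q ^ 7 * T₁₀ * (T₁₆ * T₃₂) + q ^ 13 * T₁₀ * T₈ * T₁₆ + q ^ 2 * (ψ * F)
        ≈⟨ solve 9 (λ q T₈ T₁₀ T₁₆ T₂₄ T₃₀ T₃₂ ψ F →
             T₃₀ :* T₃₂ :* T₂₄ :+ q :^ 6 :* T₂₄ :* T₈ :* T₃₀
             :+ q :^ 7 :* T₁₀ :* (T₁₆ :* T₃₂) :+ q :^ 13 :* T₁₀ :* T₈ :* T₁₆ :+ q :^ 2 :* (ψ :* F)
             := (T₂₄ :* T₃₀ :+ q :^ 7 :* (T₁₆ :* T₁₀)) :* (T₃₂ :+ q :^ 6 :* T₈) :+ q :^ 2 :* (ψ :* F))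
             refl q T₈ T₁₀ T₁₆ T₂₄ T₃₀ T₃₂ ψ F ⟩
      (T₂₄ * T₃₀ + q ^ 7 * (T₁₆ * T₁₀)) * (T₃₂ + q ^ 6 * T₈) + q ^ 2 * (ψ * F) ∎

  yf₆≈q³xf₂+Δ : y * f₆ ≈ q ^ 3 * (x * f₂) + Δ
  yf₆≈q³xf₂+Δ = trans (*-cong y-expand f₆-expand) (trans
    (algebra q (θ₈₀ 8) (θ₈₀ 10) (θ₈₀ 16) (θ₈₀ 24) (θ₈₀ 30) (θ₈₀ 32) _ _ θ⁻5,15-expand θ⁻4,36*θ⁻12,28-expand)
    (sym (+-congʳ (*-congˡ (*-cong x-expand f₂-expand)))))
    where
    -- The same device: q^9 T₈ T₁₀ T₂₄ occurs twice after the substitution, and each copy restores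
    -- one of the hypotheses.
    algebra : ∀ q T₈ T₁₀ T₁₆ T₂₄ T₃₀ T₃₂ ψ F → ψ + q ^ 5 * T₁₀ ≈ T₃₀ → F + q ^ 4 * (T₂₄ * T₈) ≈ T₁₆ * T₃₂ →
      (T₁₆ * T₃₀ + q ^ 3 * (T₂₄ * T₁₀)) * (T₃₂ + q ^ 6 * T₈)
      ≈ q ^ 3 * ((T₁₀ * T₃₂ + q ^ 1 * (T₃₀ * T₈)) * (T₂₄ + q ^ 2 * T₁₆)) + ψ * F
    algebra q T₈ T₁₀ T₁₆ T₂₄ T₃₀ T₃₂ ψ F hψ hF = begin
      (T₁₆ * T₃₀ + q ^ 3 * (T₂₄ * T₁₀)) * (T₃₂ + q ^ 6 * T₈)
        ≈⟨ solve 7 (λ q T₈ T₁₀ T₁₆ T₂₄ T₃₀ T₃₂ →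
             (T₁₆ :* T₃₀ :+ q :^ 3 :* (T₂₄ :* T₁₀)) :* (T₃₂ :+ q :^ 6 :* T₈)
             := q :^ 3 :* (T₂₄ :* T₁₀) :* (T₃₂ :+ q :^ 6 :* T₈) :+ q :^ 6 :* T₁₆ :* T₃₀ :* T₈ :+ T₃₀ :* (T₁₆ :* T₃₂))
             refl q T₈ T₁₀ T₁₆ T₂₄ T₃₀ T₃₂ ⟩
      q ^ 3 * (T₂₄ * T₁₀) * (T₃₂ + q ^ 6 * T₈) + q ^ 6 * T₁₆ * T₃₀ * T₈ + T₃₀ * (T₁₆ * T₃₂)
        ≈⟨ +-congˡ (*-cong hψ hF) ⟨
      q ^ 3 * (T₂₄ * T₁₀) * (T₃₂ + q ^ 6 * T₈) + q ^ 6 * T₁₆ * T₃₀ * T₈ + (ψ + q ^ 5 * T₁₀) * (F + q ^ 4 * (T₂₄ * T₈))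
        ≈⟨ solve 9 (λ q T₈ T₁₀ T₁₆ T₂₄ T₃₀ T₃₂ ψ F →
             q :^ 3 :* (T₂₄ :* T₁₀) :* (T₃₂ :+ q :^ 6 :* T₈) :+ q :^ 6 :* T₁₆ :* T₃₀ :* T₈ :+ (ψ :+ q :^ 5 :* T₁₀) :* (F :+ q :^ 4 :* (T₂₄ :* T₈))
             := q :^ 3 :* T₂₄ :* T₁₀ :* T₃₂ :+ q :^ 6 :* T₁₆ :* T₃₀ :* T₈ :+ q :^ 4 :* T₂₄ :* T₈ :* (ψ :+ q :^ 5 :* T₁₀)
                :+ q :^ 5 :* T₁₀ :* (F :+ q :^ 4 :* (T₂₄ :* T₈)) :+ ψ :* F)
             refl q T₈ T₁₀ T₁₆ T₂₄ T₃₀ T₃₂ ψ F ⟩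
      q ^ 3 * T₂₄ * T₁₀ * T₃₂ + q ^ 6 * T₁₆ * T₃₀ * T₈ + q ^ 4 * T₂₄ * T₈ * (ψ + q ^ 5 * T₁₀)
        + q ^ 5 * T₁₀ * (F + q ^ 4 * (T₂₄ * T₈)) + ψ * F
        ≈⟨ +-congʳ (+-cong (+-congˡ (*-congˡ hψ)) (*-congˡ hF)) ⟩
      q ^ 3 * T₂₄ * T₁₀ * T₃₂ + q ^ 6 * T₁₆ * T₃₀ * T₈ + q ^ 4 * T₂₄ * T₈ * T₃₀
        + q ^ 5 * T₁₀ * (T₁₆ * T₃₂) + ψ * F
        ≈⟨ solve 9 (λ q T₈ T₁₀ T₁₆ T₂₄ T₃₀ T₃₂ ψ F →
             q :^ 3 :* T₂₄ :* T₁₀ :* T₃₂ :+ q :^ 6 :* T₁₆ :* T₃₀ :* T₈ :+ q :^ 4 :* T₂₄ :* T₈ :* T₃₀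
             :+ q :^ 5 :* T₁₀ :* (T₁₆ :* T₃₂) :+ ψ :* F
             := q :^ 3 :* ((T₁₀ :* T₃₂ :+ q :^ 1 :* (T₃₀ :* T₈)) :* (T₂₄ :+ q :^ 2 :* T₁₆)) :+ ψ :* F)
             refl q T₈ T₁₀ T₁₆ T₂₄ T₃₀ T₃₂ ψ F ⟩
      q ^ 3 * ((T₁₀ * T₃₂ + q ^ 1 * (T₃₀ * T₈)) * (T₂₄ + q ^ 2 * T₁₆)) + ψ * F ∎

  Δ-cancel : ∀ {u v} → Δ * u ≈ Δ * v → u ≈ v
  Δ-cancel {u} {v} e = begin
    u             ≈⟨ restore u ⟨
    d * (Δ * u)   ≈⟨ *-congˡ e ⟩
    d * (Δ * v)   ≈⟨ restore v ⟩
    v             ∎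
    where
    d : Carrier
    d = proj₁ Δ-inverse
    restore : ∀ u → d * (Δ * u) ≈ u
    restore u = trans (sym (*-assoc _ _ _)) (trans (*-congʳ (trans (*-comm _ _) (proj₂ Δ-inverse))) (*-identityˡ u))

  private
    quotient : ∀ {a b u} → a * b ≈ Δ → b * u ≈ 1# → Δ * u ≈ a
    quotient ab≈Δ bu≈1 = trans (*-congʳ (sym ab≈Δ)) (trans (*-assoc _ _ _) (trans (*-congˡ bu≈1) (*-identityʳ _)))

  -- FS and FT are arbitrary inverses of the two products; partition counts are inserted for them
  -- later. Multiplication by Δ turns the claim into the theta identity.
  reciprocals₁ : ∀ {FS FT} → ∏ₗ (± S₁) * FS ≈ 1# → ∏ₗ (± T₁) * FT ≈ 1# → FT ≈ FS + q ^ 2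
  reciprocals₁ {FS} {FT} S*FS≈1 T*FT≈1 = Δ-cancel (begin
    Δ * FT                 ≈⟨ quotient z-T₁ T*FT≈1 ⟩
    z * f₂                 ≈⟨ zf₂≈wf₆+q²Δ ⟩
    w * f₆ + q ^ 2 * Δ     ≈⟨ +-cong (quotient w-S₁ S*FS≈1) (*-comm Δ (q ^ 2)) ⟨
    Δ * FS + Δ * q ^ 2     ≈⟨ distribˡ _ _ _ ⟨
    Δ * (FS + q ^ 2)       ∎)

  reciprocals₂ : ∀ {FS FT} → ∏ₗ (± S₂) * FS ≈ 1# → ∏ₗ (± T₂) * FT ≈ 1# → FS ≈ q ^ 3 * FT + 1#
  reciprocals₂ {FS} {FT} S*FS≈1 T*FT≈1 = Δ-cancel (begin
    Δ * FS                        ≈⟨ quotient y-S₂ S*FS≈1 ⟩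
    y * f₆                        ≈⟨ yf₆≈q³xf₂+Δ ⟩
    q ^ 3 * (x * f₂) + Δ          ≈⟨ +-cong (*-congˡ (quotient x-T₂ T*FT≈1)) (*-identityʳ Δ) ⟨
    q ^ 3 * (Δ * FT) + Δ * 1#     ≈⟨ +-congʳ (x∙yz≈y∙xz _ _ _) ⟩
    Δ * (q ^ 3 * FT) + Δ * 1#     ≈⟨ distribˡ _ _ _ ⟨
    Δ * (q ^ 3 * FT + 1#)         ∎)

-- Recurrences for bounded partition counts.

module ℕ-fold = FiniteFold ℕ.+-0-commutativeMonoid

if-≰ : ∀ {m n} (x : ℕ) → ¬ m ℕ.≤ n → (if m ≤ᵇ n then x else 0) ≡ 0
if-≰ {m} {n} x m≰n with m ≤ᵇ n in e
... | false = ≡.refl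
... | true  = contradiction (ℕ.≤ᵇ⇒≤ m n (subst T (≡.sym e) tt)) m≰n

+-≤ᵇ-+ : ∀ k m n → (k ℕ.+ m ≤ᵇ k ℕ.+ n) ≡ (m ≤ᵇ n)
+-≤ᵇ-+ zero    m n = ≡.refl
+-≤ᵇ-+ (suc k) m n = ≡.trans (suc-≤ᵇ-suc (k ℕ.+ m) (k ℕ.+ n)) (+-≤ᵇ-+ k m n)
  where
  suc-≤ᵇ-suc : ∀ m n → (suc m ≤ᵇ suc n) ≡ (m ≤ᵇ n)
  suc-≤ᵇ-suc zero    n = ≡.refl
  suc-≤ᵇ-suc (suc m) n = ≡.refl

sum-map-filterᵇ : ∀ P (g : ℕ → ℕ) f n →
  sum (map g (filterᵇ P (applyUpTo f n))) ≡ ℕ-fold.fold n (λ i → if P (f i) then g (f i) else 0)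
sum-map-filterᵇ P g f zero    = ≡.refl
sum-map-filterᵇ P g f (suc n) with P (f 0)
... | false = sum-map-filterᵇ P g (f ∘ suc) n
... | true  = cong (g (f 0) ℕ.+_) (sum-map-filterᵇ P g (f ∘ suc) n)

-- The coefficient of q^n in (∑ g(m) q^m) / (1 - q^(k+1)).
multiplicitySum : (ℕ → ℕ) → ℕ → ℕ → ℕ
multiplicitySum g k n = ℕ-fold.fold (suc n) (λ j → if j ℕ.* suc k ≤ᵇ n then g (n ∸ j ℕ.* suc k) else 0)

multiplicitySum-< : ∀ g k n → n ℕ.< suc k → multiplicitySum g k n ≡ g n
multiplicitySum-< g k n n<k = ≡.trans
  (cong (g n ℕ.+_) (≡.trans (ℕ-fold.fold-cong′ n (λ j → if-≰ _ (ℕ.<⇒≱ (ℕ.<-≤-trans n<k (ℕ.m≤m+n (suc k) _)))))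
                            (ℕ-fold.fold-ε n)))
  (ℕ.+-identityʳ (g n))

-- The terms with j ≥ 1 are those for n after one part k + 1 has been removed; the surplus indices j
-- > n contribute zero.
multiplicitySum-+ : ∀ g k n →
  multiplicitySum g k (suc k ℕ.+ n) ≡ g (suc k ℕ.+ n) ℕ.+ multiplicitySum g k n
multiplicitySum-+ g k n = cong (g (suc k ℕ.+ n) ℕ.+_) (begin
  ℕ-fold.fold (suc k ℕ.+ n) (λ j → if suc k ℕ.+ j ℕ.* suc k ≤ᵇ suc k ℕ.+ n
                                   then g ((suc k ℕ.+ n) ∸ (suc k ℕ.+ j ℕ.* suc k)) else 0)
    ≡⟨ ℕ-fold.fold-cong′ (suc k ℕ.+ n) (λ j → cong₂ (λ b x → if b then g x else 0)
         (+-≤ᵇ-+ (suc k) (j ℕ.* suc k) n) (ℕ.[m+n]∸[m+o]≡n∸o (suc k) n (j ℕ.* suc k))) ⟩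
  ℕ-fold.fold (suc k ℕ.+ n) h
    ≡⟨ cong (λ m → ℕ-fold.fold m h) (cong suc (ℕ.+-comm k n)) ⟩
  ℕ-fold.fold (suc n ℕ.+ k) h
    ≡⟨ ℕ-fold.fold-extend (suc n) k (λ j n<j → if-≰ (g (n ∸ j ℕ.* suc k)) (ℕ.<⇒≱ (ℕ.<-≤-trans n<j (ℕ.m≤m*n j (suc k))))) ⟩
  ℕ-fold.fold (suc n) h ∎)
  where
  open ≡.≡-Reasoning
  h : ℕ → ℕ
  h j = if j ℕ.* suc k ≤ᵇ n then g (n ∸ j ℕ.* suc k) else 0

pBounded-∉ : ∀ S k n → S (suc k) ≡ false → pBounded S (suc k) n ≡ pBounded S k n
pBounded-∉ S k n e rewrite e = ≡.refl

pBounded-∈ : ∀ S k n → S (suc k) ≡ true → pBounded S (suc k) n ≡ multiplicitySum (pBounded S k) k n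
pBounded-∈ S k n e rewrite e = sum-map-filterᵇ (λ j → j ℕ.* suc k ≤ᵇ n) (λ j → pBounded S k (n ∸ j ℕ.* suc k)) id (suc n)

pBounded-< : ∀ S k n → n ℕ.< suc k → pBounded S (suc k) n ≡ pBounded S k n
pBounded-< S k n n<k with S (suc k) in e
... | false = ≡.refl
... | true  = ≡.trans (sum-map-filterᵇ (λ j → j ℕ.* suc k ≤ᵇ n) (λ j → pBounded S k (n ∸ j ℕ.* suc k)) id (suc n))
                (multiplicitySum-< (pBounded S k) k n n<k)

-- Allowing parts larger than n changes nothing, so a single bound serves all coefficients below it.
pBounded≡p : ∀ S n d → pBounded S (d ℕ.+ n) n ≡ p S n
pBounded≡p S n zero    = ≡.refl
pBounded≡p S n (suc d) = ≡.trans (pBounded-< S (d ℕ.+ n) n (ℕ.s≤s (ℕ.m≤n+m n d))) (pBounded≡p S n d)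

pmSet-periodic : ∀ rs r i → pmSet 80 rs (suc (r ℕ.+ i ℕ.* 80)) ≡ pmSet 80 rs (suc r)
pmSet-periodic rs r i = cong or (map-cong (λ s → cong₂ (λ x y → (x ≡ᵇ (s % 80)) ∨ (y ≡ᵇ 0))
  ([m+kn]%n≡m%n (suc r) i 80)
  (≡.trans (cong (_% 80) (regroup r i s)) ([m+kn]%n≡m%n (suc r ℕ.+ s) i 80))) rs)
  where
  regroup : ∀ r i s → suc (r ℕ.+ i ℕ.* 80) ℕ.+ s ≡ (suc r ℕ.+ s) ℕ.+ i ℕ.* 80
  regroup = solve-∀ℕ

-- The ring of truncated power series.

Series : Set
Series = ℕ → ℤ

-- The Cauchy product, splitting off the constant term of f: f g = f(0) g + q (tail of f) g.
mul : Series → Series → Series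
mul f g zero    = f 0 ℤ.* g 0
mul f g (suc n) = f 0 ℤ.* g (suc n) ℤ.+ mul (f ∘ suc) g n

one : Series
one zero    = + 1
one (suc n) = + 0

mul-cong : ∀ n {f f′ g g′ : Series} → (∀ i → i ℕ.≤ n → f i ≡ f′ i) → (∀ i → i ℕ.≤ n → g i ≡ g′ i) →
           mul f g n ≡ mul f′ g′ n
mul-cong zero    ef eg = cong₂ ℤ._*_ (ef 0 ℕ.z≤n) (eg 0 ℕ.z≤n)
mul-cong (suc n) ef eg = cong₂ ℤ._+_ (cong₂ ℤ._*_ (ef 0 ℕ.z≤n) (eg (suc n) ℕ.≤-refl))
  (mul-cong n (λ i i≤n → ef (suc i) (ℕ.s≤s i≤n)) (λ i i≤n → eg i (ℕ.m≤n⇒m≤1+n i≤n)))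

mul-zeroˡ : ∀ g n → mul (λ _ → + 0) g n ≡ + 0
mul-zeroˡ g zero    = ≡.refl
mul-zeroˡ g (suc n) = ≡.trans (ℤ.+-identityˡ _) (mul-zeroˡ g n)

mul-identityˡ : ∀ g n → mul one g n ≡ g n
mul-identityˡ g zero    = ℤ.*-identityˡ (g 0)
mul-identityˡ g (suc n) = ≡.trans (cong₂ ℤ._+_ (ℤ.*-identityˡ (g (suc n))) (mul-zeroˡ g n)) (ℤ.+-identityʳ _)

mul-distribʳ : ∀ h f g n → mul (λ i → f i ℤ.+ g i) h n ≡ mul f h n ℤ.+ mul g h n
mul-distribʳ h f g zero    = ℤ.*-distribʳ-+ (h 0) (f 0) (g 0)
mul-distribʳ h f g (suc n) = ≡.trans
  (cong (λ x → (f 0 ℤ.+ g 0) ℤ.* h (suc n) ℤ.+ x) (mul-distribʳ h (f ∘ suc) (g ∘ suc) n))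
  (regroup (f 0) (g 0) (h (suc n)) (mul (f ∘ suc) h n) (mul (g ∘ suc) h n))
  where
  regroup : ∀ a b c x y → (a ℤ.+ b) ℤ.* c ℤ.+ (x ℤ.+ y) ≡ (a ℤ.* c ℤ.+ x) ℤ.+ (b ℤ.* c ℤ.+ y)
  regroup = solve-∀

mul-scale : ∀ c f g n → mul (λ i → c ℤ.* f i) g n ≡ c ℤ.* mul f g n
mul-scale c f g zero    = ℤ.*-assoc c (f 0) (g 0)
mul-scale c f g (suc n) = ≡.trans
  (cong₂ ℤ._+_ (ℤ.*-assoc c (f 0) (g (suc n))) (mul-scale c (f ∘ suc) g n))
  (≡.sym (ℤ.*-distribˡ-+ c _ _))

-- The mirror image of the defining recursion, from which commutativity follows by induction.
mul-sucʳ : ∀ f g n → mul f g (suc n) ≡ mul f (g ∘ suc) n ℤ.+ f (suc n) ℤ.* g 0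
mul-sucʳ f g zero    = ≡.refl
mul-sucʳ f g (suc n) = ≡.trans
  (cong (λ x → f 0 ℤ.* g (suc (suc n)) ℤ.+ x) (mul-sucʳ (f ∘ suc) g n))
  (≡.sym (ℤ.+-assoc (f 0 ℤ.* g (suc (suc n))) _ _))

mul-comm : ∀ f g n → mul f g n ≡ mul g f n
mul-comm f g zero    = ℤ.*-comm (f 0) (g 0)
mul-comm f g (suc n) = begin
  f 0 ℤ.* g (suc n) ℤ.+ mul (f ∘ suc) g n   ≡⟨ cong₂ ℤ._+_ (ℤ.*-comm (f 0) _) (mul-comm (f ∘ suc) g n) ⟩
  g (suc n) ℤ.* f 0 ℤ.+ mul g (f ∘ suc) n   ≡⟨ ℤ.+-comm (g (suc n) ℤ.* f 0) _ ⟩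
  mul g (f ∘ suc) n ℤ.+ g (suc n) ℤ.* f 0   ≡⟨ mul-sucʳ g f n ⟨
  mul g f (suc n)                           ∎
  where open ≡.≡-Reasoning

mul-assoc : ∀ f g h n → mul (mul f g) h n ≡ mul f (mul g h) n
mul-assoc f g h zero    = ℤ.*-assoc (f 0) (g 0) (h 0)
mul-assoc f g h (suc n) = begin
  (f 0 ℤ.* g 0) ℤ.* h (suc n) ℤ.+ mul (λ i → f 0 ℤ.* g (suc i) ℤ.+ mul (f ∘ suc) g i) h n
    ≡⟨ cong (λ x → (f 0 ℤ.* g 0) ℤ.* h (suc n) ℤ.+ x)
         (≡.trans (mul-distribʳ h (λ i → f 0 ℤ.* g (suc i)) (mul (f ∘ suc) g) n)
                  (cong₂ ℤ._+_ (mul-scale (f 0) (g ∘ suc) h n) (mul-assoc (f ∘ suc) g h n))) ⟩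
  (f 0 ℤ.* g 0) ℤ.* h (suc n) ℤ.+ (f 0 ℤ.* mul (g ∘ suc) h n ℤ.+ mul (f ∘ suc) (mul g h) n)
    ≡⟨ regroup (f 0) (g 0) (h (suc n)) (mul (g ∘ suc) h n) (mul (f ∘ suc) (mul g h) n) ⟩
  f 0 ℤ.* (g 0 ℤ.* h (suc n) ℤ.+ mul (g ∘ suc) h n) ℤ.+ mul (f ∘ suc) (mul g h) n ∎
  where
  open ≡.≡-Reasoning
  regroup : ∀ a b c x y → (a ℤ.* b) ℤ.* c ℤ.+ (a ℤ.* x ℤ.+ y) ≡ a ℤ.* (b ℤ.* c ℤ.+ x) ℤ.+ y
  regroup = solve-∀

-- ℤ[[q]]/(q^K): since q is nilpotent, infinite sums and products truncate to finite ones.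
truncated : ℕ → CommutativeRing 0ℓ 0ℓ
truncated K = record
  { Carrier = Series
  ; _≈_     = λ f g → ∀ n → n ℕ.< K → f n ≡ g n
  ; _+_     = λ f g n → f n ℤ.+ g n
  ; _*_     = mul
  ; -_      = λ f n → ℤ.- f n
  ; 0#      = λ _ → + 0
  ; 1#      = one
  ; isCommutativeRing = record
    { isRing = record
      { +-isAbelianGroup = record
        { isGroup = record
          { isMonoid = record
            { isSemigroup = record
              { isMagma = record
                { isEquivalence = record
                  { refl  = λ _ _ → ≡.refl
                  ; sym   = λ e n n<K → ≡.sym (e n n<K)
                  ; trans = λ e e′ n n<K → ≡.trans (e n n<K) (e′ n n<K)
                  }
                ; ∙-cong = λ e e′ n n<K → cong₂ ℤ._+_ (e n n<K) (e′ n n<K)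
                }
              ; assoc = λ f g h n _ → ℤ.+-assoc (f n) (g n) (h n)
              }
            ; identity = (λ f n _ → ℤ.+-identityˡ (f n)) , (λ f n _ → ℤ.+-identityʳ (f n))
            }
          ; inverse = (λ f n _ → ℤ.+-inverseˡ (f n)) , (λ f n _ → ℤ.+-inverseʳ (f n))
          ; ⁻¹-cong = λ e n n<K → cong ℤ.-_ (e n n<K)
          }
        ; comm = λ f g n _ → ℤ.+-comm (f n) (g n)
        }
      ; *-cong     = λ e e′ n n<K → mul-cong n (λ i i≤n → e i (ℕ.≤-<-trans i≤n n<K)) (λ i i≤n → e′ i (ℕ.≤-<-trans i≤n n<K))
      ; *-assoc    = λ f g h n _ → mul-assoc f g h n
      ; *-identity = (λ f n _ → mul-identityˡ f n) , (λ f n _ → ≡.trans (mul-comm f one n) (mul-identityˡ f n))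
      ; distrib    = (λ h f g n _ → ≡.trans (mul-comm h _ n)
                        (≡.trans (mul-distribʳ h f g n) (cong₂ ℤ._+_ (mul-comm f h n) (mul-comm g h n))))
                   , (λ h f g n _ → mul-distribʳ h f g n)
      }
    ; *-comm = λ f g n _ → mul-comm f g n
    }
  }

indeterminate : Series
indeterminate zero    = + 0
indeterminate (suc n) = one n

-- Generating functions of partition counts.

module Partitions (K : ℕ) where
  open CommutativeRing (truncated K)
  open Exp semiring using (_^_)

  q : Series
  q = indeterminate

  q*-suc : ∀ f n → mul q f (suc n) ≡ f n
  q*-suc f n = ≡.trans (ℤ.+-identityˡ _) (mul-identityˡ f n)

  q^*-< : ∀ m f n → n ℕ.< m → mul (q ^ m) f n ≡ + 0
  q^*-< (suc m) f zero    _         = ≡.refl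
  q^*-< (suc m) f (suc n) (ℕ.s≤s n<m) =
    ≡.trans (mul-assoc q (q ^ m) f (suc n)) (≡.trans (q*-suc (mul (q ^ m) f) n) (q^*-< m f n n<m))

  q^*-+ : ∀ m f n → mul (q ^ m) f (m ℕ.+ n) ≡ f n
  q^*-+ zero    f n = mul-identityˡ f n
  q^*-+ (suc m) f n =
    ≡.trans (mul-assoc q (q ^ m) f (suc m ℕ.+ n)) (≡.trans (q*-suc (mul (q ^ m) f) (m ℕ.+ n)) (q^*-+ m f n))

  q^n≈0 : NilpotentFrom (truncated K) K q
  q^n≈0 n K≤n i i<K = ≡.trans (≡.sym (*-identityʳ (q ^ n) i i<K)) (q^*-< n one i (ℕ.<-≤-trans i<K K≤n))

  open TripleProduct (truncated K) q K q^n≈0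
  open ThetaIdentities (truncated K) q K q^n≈0
  open import Relation.Binary.Reasoning.Setoid setoid

  partitions : PartSet → ℕ → Series
  partitions S k n = + pBounded S k n

  factor : PartSet → ℕ → Series
  factor S j = if S j then 1# + - 1# * q ^ j else 1#

  -- If k + 1 is in S, a partition either avoids the part k + 1 or loses one copy of it: G_(k+1) =
  -- G_k + q^(k+1) G_(k+1).
  factor-partitions : ∀ S k → factor S (suc k) * partitions S (suc k) ≈ partitions S k
  factor-partitions S k = split (S (suc k)) ≡.refl
    where
    recurrence : ∀ n → S (suc k) ≡ true →
      partitions S (suc k) n ≡ partitions S k n ℤ.+ mul (q ^ suc k) (partitions S (suc k)) n
    recurrence n e with n ℕ.<? suc k
    ... | yes n<k = ≡.sym (≡.trans
      (cong (λ x → partitions S k n ℤ.+ x) (q^*-< (suc k) _ n n<k))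
      (≡.trans (ℤ.+-identityʳ _) (cong +_ (≡.sym (pBounded-< S k n n<k)))))
    ... | no n≮k = subst
      (λ n → partitions S (suc k) n ≡ partitions S k n ℤ.+ mul (q ^ suc k) (partitions S (suc k)) n)
      (ℕ.m+[n∸m]≡n (ℕ.≮⇒≥ n≮k)) (shifted (n ∸ suc k))
      where
      shifted : ∀ m → partitions S (suc k) (suc k ℕ.+ m) ≡
        partitions S k (suc k ℕ.+ m) ℤ.+ mul (q ^ suc k) (partitions S (suc k)) (suc k ℕ.+ m)
      shifted m = ≡.trans
        (cong +_ (≡.trans (pBounded-∈ S k (suc k ℕ.+ m) e)
          (≡.trans (multiplicitySum-+ (pBounded S k) k m)
            (cong (pBounded S k (suc k ℕ.+ m) ℕ.+_) (≡.sym (pBounded-∈ S k m e))))))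
        (cong (λ x → partitions S k (suc k ℕ.+ m) ℤ.+ x) (≡.sym (q^*-+ (suc k) (partitions S (suc k)) m)))

    split : ∀ b → S (suc k) ≡ b → (if b then 1# + - 1# * q ^ suc k else 1#) * partitions S (suc k) ≈ partitions S k
    split false e = λ n n<K → ≡.trans (mul-identityˡ _ n) (cong +_ (pBounded-∉ S k n e))
    split true  e = +-cancelʳ (q ^ suc k * partitions S (suc k)) (begin
      (1# + - 1# * q ^ suc k) * partitions S (suc k) + q ^ suc k * partitions S (suc k)
        ≈⟨ distribʳ _ _ _ ⟨
      ((1# + - 1# * q ^ suc k) + q ^ suc k) * partitions S (suc k)
        ≈⟨ trans (*-congʳ (1-x+x (q ^ suc k))) (*-identityˡ _) ⟩
      partitions S (suc k)
        ≈⟨ (λ n _ → recurrence n e) ⟩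
      partitions S k + q ^ suc k * partitions S (suc k) ∎)

  ∏-factor-partitions : ∀ S k → ∏ k (λ j → factor S (suc j)) * partitions S k ≈ 1#
  ∏-factor-partitions S zero    = trans (*-identityˡ _) (λ { zero _ → ≡.refl ; (suc n) _ → ≡.refl })
  ∏-factor-partitions S (suc k) = begin
    ∏ (suc k) (λ j → factor S (suc j)) * partitions S (suc k)
      ≈⟨ *-congʳ (∏-last k _) ⟩
    (∏ k (λ j → factor S (suc j)) * factor S (suc k)) * partitions S (suc k)
      ≈⟨ trans (*-assoc _ _ _) (*-congˡ (factor-partitions S k)) ⟩
    ∏ k (λ j → factor S (suc j)) * partitions S k
      ≈⟨ ∏-factor-partitions S k ⟩
    1# ∎

  ∏-filterᵇ : ∀ P f m → ∏ m (λ i → if P (f i) then poch₈₀ (f i) else 1#) ≈ ∏ₗ (filterᵇ P (applyUpTo f m))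
  ∏-filterᵇ P f zero    = refl
  ∏-filterᵇ P f (suc m) with P (f 0)
  ... | false = trans (*-identityˡ _) (∏-filterᵇ P (f ∘ suc) m)
  ... | true  = *-congˡ (∏-filterᵇ P (f ∘ suc) m)

  -- The bound 80 K consists of K whole periods, so each residue class contributes exactly the K
  -- factors of `poch₈₀`.
  ∏-factor-pmSet : ∀ rs → ∏ (K ℕ.* 80) (λ j → factor (pmSet 80 rs) (suc j)) ≈
                          ∏ₗ (filterᵇ (pmSet 80 rs) (applyUpTo suc 80))
  ∏-factor-pmSet rs = begin
    ∏ (K ℕ.* 80) (λ j → factor S (suc j))
      ≈⟨ ∏-block K 80 _ ⟩
    ∏ K (λ i → ∏ 80 (λ r → factor S (suc (r ℕ.+ i ℕ.* 80))))
      ≈⟨ ∏-swap K 80 (λ i r → factor S (suc (r ℕ.+ i ℕ.* 80))) ⟩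
    ∏ 80 (λ r → ∏ K (λ i → factor S (suc (r ℕ.+ i ℕ.* 80))))
      ≈⟨ ∏-cong′ 80 residue ⟩
    ∏ 80 (λ r → if S (suc r) then poch₈₀ (suc r) else 1#)
      ≈⟨ ∏-filterᵇ S suc 80 ⟩
    ∏ₗ (filterᵇ S (applyUpTo suc 80)) ∎
    where
    S : PartSet
    S = pmSet 80 rs
    residue : ∀ r → ∏ K (λ i → factor S (suc (r ℕ.+ i ℕ.* 80))) ≈ (if S (suc r) then poch₈₀ (suc r) else 1#)
    residue r = trans
      (∏-cong′ K (λ i → reflexive (cong (λ b → if b then 1# + - 1# * q ^ (suc r ℕ.+ i ℕ.* 80) else 1#) (pmSet-periodic rs r i))))
      select
      where
      select : ∏ K (λ i → if S (suc r) then 1# + - 1# * q ^ (suc r ℕ.+ i ℕ.* 80) else 1#) ≈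
               (if S (suc r) then poch₈₀ (suc r) else 1#)
      select with S (suc r)
      ... | true  = refl
      ... | false = ∏-1 K

  -- The bound on the parts is a multiple of the period and at least K, so the coefficients below
  -- q^K are the unrestricted counts.
  generating : List ℕ → Series
  generating rs = partitions (pmSet 80 rs) (K ℕ.* 80)

  generating-inverse : ∀ rs ss → filterᵇ (pmSet 80 rs) (applyUpTo suc 80) ↭ ss → ∏ₗ ss * generating rs ≈ 1#
  generating-inverse rs ss rs↭ss = trans
    (*-congʳ (sym (trans (∏-factor-pmSet rs) (∏ₗ-↭ rs↭ss))))
    (∏-factor-partitions (pmSet 80 rs) (K ℕ.* 80))

  generating-coefficient : ∀ rs n → n ℕ.< K → generating rs n ≡ + p (pmSet 80 rs) n
  generating-coefficient rs n n<K = cong +_ (≡.trans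
    (cong (λ k → pBounded (pmSet 80 rs) k n) (≡.sym (ℕ.m∸n+n≡m (ℕ.≤-trans (ℕ.<⇒≤ n<K) (ℕ.m≤m*n K 80)))))
    (pBounded≡p (pmSet 80 rs) n (K ℕ.* 80 ∸ n)))

  generating₁ : generating T₁ ≈ generating S₁ + q ^ 2
  generating₁ = reciprocals₁ (generating-inverse S₁ (± S₁) (sort-≡⇒↭ ≡.refl)) (generating-inverse T₁ (± T₁) (sort-≡⇒↭ ≡.refl))

  generating₂ : generating S₂ ≈ q ^ 3 * generating T₂ + 1#
  generating₂ = reciprocals₂ (generating-inverse S₂ (± S₂) (sort-≡⇒↭ ≡.refl)) (generating-inverse T₂ (± T₂) (sort-≡⇒↭ ≡.refl))

  q²-coefficient : ∀ n → n ≢ 2 → (q ^ 2) n ≡ + 0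
  q²-coefficient 0 _ = ≡.refl
  q²-coefficient 1 _ = ≡.refl
  q²-coefficient 2 2≢2 = contradiction ≡.refl 2≢2
  q²-coefficient (suc (suc (suc n))) _ =
    ≡.trans (q*-suc (mul q one) (suc (suc n))) (q*-suc one (suc n))

theorem19p1 : ((n : ℕ) → n ≢ 2 →
    p (pmSet 80 (4 ∷ 5 ∷ 6 ∷ 7 ∷ 15 ∷ 17 ∷ 23 ∷ 25 ∷ 26 ∷ 33 ∷ 35 ∷ 36 ∷ [])) n
    ≡ p (pmSet 80 (2 ∷ 5 ∷ 11 ∷ 12 ∷ 15 ∷ 18 ∷ 19 ∷ 21 ∷ 25 ∷ 28 ∷ 29 ∷ 35 ∷ [])) n)
    ×
    ((n : ℕ) → n ≥ 3 →
    p (pmSet 80 (3 ∷ 4 ∷ 5 ∷ 13 ∷ 14 ∷ 15 ∷ 25 ∷ 27 ∷ 34 ∷ 35 ∷ 36 ∷ 37 ∷ [])) n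
    ≡ p (pmSet 80 (1 ∷ 5 ∷ 9 ∷ 12 ∷ 15 ∷ 22 ∷ 25 ∷ 28 ∷ 31 ∷ 35 ∷ 38 ∷ 39 ∷ [])) (n ∸ 3))
theorem19p1 = part₁ , part₂
  where
  open ≡.≡-Reasoning

  part₁ : ∀ n → n ≢ 2 → p (pmSet 80 S₁) n ≡ p (pmSet 80 T₁) n
  part₁ n n≢2 = ℤ.+-injective (begin
    + p (pmSet 80 S₁) n                  ≡⟨ generating-coefficient S₁ n ℕ.≤-refl ⟨
    generating S₁ n                      ≡⟨ ℤ.+-identityʳ _ ⟨
    generating S₁ n ℤ.+ + 0              ≡⟨ cong (λ x → generating S₁ n ℤ.+ x) (q²-coefficient n n≢2) ⟨
    _                                    ≡⟨ generating₁ n ℕ.≤-refl ⟨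
    generating T₁ n                      ≡⟨ generating-coefficient T₁ n ℕ.≤-refl ⟩
    + p (pmSet 80 T₁) n                  ∎)
    -- Truncation at q^(n+1) is the coarsest that still sees the coefficient of q^n.
    where open Partitions (suc n)

  part₂ : ∀ n → n ≥ 3 → p (pmSet 80 S₂) n ≡ p (pmSet 80 T₂) (n ∸ 3)
  part₂ (suc (suc (suc m))) _ = ℤ.+-injective (begin
    + p (pmSet 80 S₂) n                  ≡⟨ generating-coefficient S₂ n ℕ.≤-refl ⟨
    generating S₂ n                      ≡⟨ generating₂ n ℕ.≤-refl ⟩
    -- The summand 1 has no coefficient in degree n = 3 + m.
    _                                    ≡⟨ ℤ.+-identityʳ _ ⟩
    _                                    ≡⟨ q^*-+ 3 (generating T₂) m ⟩
    generating T₂ m                      ≡⟨ generating-coefficient T₂ m (ℕ.m≤n+m (suc m) 3) ⟩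
    + p (pmSet 80 T₂) m                  ∎)
    where
    n : ℕ
    n = 3 ℕ.+ m
    open Partitions (suc n)
  part₂ (suc zero) (ℕ.s≤s ())
  part₂ (suc (suc zero)) (ℕ.s≤s (ℕ.s≤s ()))
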